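{- For all $N\ge 11$ and $1\le k\le N-5$, \[ B^c_{(1,4,9)}(N,k)=4\,\mathcal{C}_1(N,k)-9\,\mathcal{C}_2(N,k)+2\,\mathcal{C}_4(N,k)+105\,\mathcal{C}_5(N,k)-206\,\mathcal{C}_6(N,k)+95\,\mathcal{C}_7(N,k)-5\,\mathcal{C}_8(N,k). \]
   Context: $\mathrm{Av}_N(321)$ is the set of permutations $\pi=\pi_1\cdots\pi_N$ of $[N]$ with no indices $a<b<c$ such that $\pi_a>\pi_b>\pi_c$. $\pi|_{[j]}$ is the permutation of $[j]$ in the same relative order as $\pi_1,\dots,\pi_j$. An entry $\pi_j$ is a left-to-right maximum if $\pi_j>\pi_l$ for all $l<j$. For a permutation $p$ of $[m]$, its number of value-saturated left-to-right maxima is the largest $r$ such that each of the values $m,m-1,\dots,m-r+1$ is a left-to-right maximum of $p$. Let $\tau(0)=\tau(1)=1$, $\tau(2)=4$, $\tau(3)=9$ and $\tau(i)=\infty$ for $i\ge4$. $B^c_{(1,4,9)}(N,k)$ is the number of $\pi\in\mathrm{Av}_N(321)$ with $\pi|_{[k]}=12\cdots k$ such that $\pi_j=N$, where $j$ is the first position $j>k$ with $\pi_j$ a left-to-right maximum and the number of value-saturated left-to-right maxima of $\pi|_{[j]}$ at least $\tau(N-j)$ (such $\pi$ are those won by this threshold strategy). The $i$-shifted ballot numbers are $\mathcal{C}_i(N,k)=\frac{k+1}{N-i+1}\binom{2(N-i)-k}{N-i}$, where binomial coefficients $\binom{a}{b}$ with $b>a$ are interpreted as $0$. -}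

module Defs where

open import Data.Bool using (Bool; true; false; _∧_; _∨_; not; if_then_else_)
open import Data.Nat using (ℕ; zero; suc; _+_; _*_; _∸_; _<ᵇ_; _≤ᵇ_; _≡ᵇ_; _⊔_)
open import Data.Nat.Combinatorics using (_C_)
open import Data.List using (List; []; _∷_; length; map; concatMap; filterᵇ; take; foldr; findᵇ; applyUpTo)
open import Data.Maybe using (Maybe; just; nothing)
open import Data.Bool.ListAction using (all; any)
open import Data.Integer using (ℤ; +_)
import Data.Integer as ℤ
open import Data.Rational using (ℚ; _/_)

-- Conventions: a permutation of [N] is a list of length N containing each of
-- the values 1,…,N; positions are 1-indexed as in the paper.

range : ℕ → ℕ → List ℕ
range a b = applyUpTo (λ t → a + t) (suc b ∸ a)

-- π_j (1-indexed; default 0 outside 1..length)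
at : List ℕ → ℕ → ℕ
at [] _ = 0
at (x ∷ xs) zero = 0
at (x ∷ xs) (suc zero) = x
at (x ∷ xs) (suc (suc j)) = at xs (suc j)

words : ℕ → ℕ → List (List ℕ)
words m zero = [] ∷ []
words m (suc n) = concatMap (λ v → map (v ∷_) (words m n)) (range 1 m)

elemᵇ : ℕ → List ℕ → Bool
elemᵇ v xs = any (λ x → x ≡ᵇ v) xs

perms : ℕ → List (List ℕ)
perms N = filterᵇ (λ w → all (λ v → elemᵇ v w) (range 1 N)) (words N N)

avoids321 : List ℕ → Bool
avoids321 π = not (any (λ a → any (λ b → any (λ c →
  (at π b <ᵇ at π a) ∧ (at π c <ᵇ at π b))
  (range (suc b) n)) (range (suc a) n)) (range 1 n))
  where n = length π

std : List ℕ → List ℕ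
std xs = map (λ x → suc (length (filterᵇ (λ y → y <ᵇ x) xs))) xs

restrict : List ℕ → ℕ → List ℕ
restrict π j = std (take j π)

isLRmaxAt : List ℕ → ℕ → Bool
isLRmaxAt p j = all (λ l → at p l <ᵇ at p j) (range 1 (j ∸ 1))

isLRmaxVal : List ℕ → ℕ → Bool
isLRmaxVal p v = any (λ j → (at p j ≡ᵇ v) ∧ isLRmaxAt p j) (range 1 (length p))

-- number of value-saturated left-to-right maxima of a permutation p of [m]:
-- the largest r ≤ m such that each of m, m-1, …, m-r+1 is a LR maximum
vsatOK : List ℕ → ℕ → Bool
vsatOK p r = all (λ t → isLRmaxVal p (length p ∸ t)) (range 0 (r ∸ 1)) ∨ (r ≡ᵇ 0)

vsat : List ℕ → ℕ
vsat p = foldr _⊔_ 0 (filterᵇ (vsatOK p) (range 0 (length p)))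

-- s ≥ τ(i), with τ(0)=τ(1)=1, τ(2)=4, τ(3)=9, τ(i)=∞ for i ≥ 4
meetsτ : ℕ → ℕ → Bool
meetsτ 0 s = 1 ≤ᵇ s
meetsτ 1 s = 1 ≤ᵇ s
meetsτ 2 s = 4 ≤ᵇ s
meetsτ 3 s = 9 ≤ᵇ s
meetsτ (suc (suc (suc (suc _)))) s = false

stopPos : ℕ → ℕ → List ℕ → Maybe ℕ
stopPos N k π = findᵇ (λ j → isLRmaxAt π j ∧ meetsτ (N ∸ j) (vsat (restrict π j)))
                      (range (suc k) N)

wins : ℕ → ℕ → List ℕ → Bool
wins N k π with stopPos N k π
... | just j  = at π j ≡ᵇ N
... | nothing = false

isIdList : List ℕ → ℕ → Bool
isIdList xs k = (length xs ≡ᵇ k) ∧ all (λ i → at xs i ≡ᵇ i) (range 1 k)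

prefixId : List ℕ → ℕ → Bool
prefixId π k = isIdList (restrict π k) k

Bc149 : ℕ → ℕ → ℕ
Bc149 N k = length (filterᵇ (λ π → avoids321 π ∧ prefixId π k ∧ wins N k π) (perms N))

-- i-shifted ballot number C_i(N,k) = (k+1)/(N-i+1) * binom(2(N-i)-k, N-i),
-- as a rational (used only with i < N, so N - i + 1 = suc (N ∸ i))
ballot : ℕ → ℕ → ℕ → ℚ
ballot i N k = (+ (suc k * ((2 * (N ∸ i) ∸ k) C (N ∸ i)))) / suc (N ∸ i)

-- Every permutation of [n + 1] arises exactly once from a permutation p of [n] by appending a last value v and
-- shifting the values ≥ v of p up by one. If p avoids 321 and s = vsat p, the result avoids 321 iff v > n ∸ s, and
-- its vsat is then s + 1 for v = n + 1 and n + 1 ∸ v otherwise. So, for a function χ of vsat, summing χ over the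
-- 321-avoiding one-step extensions yields Φ χ (s) = χ 1 + ⋯ + χ (s + 1). Starting from the prefix 12⋯k
-- (vsat = k), and noting that the strategy can only stop at one of the last four positions, this gives
-- Bc(N, k) = Φ^(N−4−k) w (k), where w counts the winning ways to append the last four entries; likewise
-- C_i(N, k) = Φ^(N−i−k) 1 (k). Both sides of the identity then satisfy F_(j+1)(a + 1) = F_(j+1)(a) + F_j(a + 2),
-- so it propagates from the last-four count w, where it is proved by induction on a, to every N; only finitely
-- many base values have to be computed.

module Submission where

open import Defs
open import Data.Nat
open import Data.Nat.Properties
open import Data.Nat.Combinatorics using (_C_; nCk+nC[k+1]≡[n+1]C[k+1]; nCk≡nC[n∸k]; k>n⇒nCk≡0; nC1≡n)
open import Data.Nat.Tactic.RingSolver using (solve-∀)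
open import Data.Bool using (Bool; true; false; T; _∧_; _∨_; not; if_then_else_)
open import Data.Bool.Properties
  using (∧-conicalˡ; ∧-conicalʳ; ∧-zeroʳ; ∧-identityʳ; ∨-zeroʳ; ∨-identityʳ; ¬-not; not-injective; if-float; if-eta)
open import Data.Bool.ListAction using (all; any)
open import Data.List using (List; []; _∷_; _++_; length; map; concatMap; concat; filterᵇ; applyUpTo; take; foldr; findᵇ)
open import Data.List.Properties using (length-map; length-++; take-map; take-all; map-cong; map-∘; map-id-local)
open import Data.List.Relation.Unary.All using (All; []; _∷_)
import Data.List.Relation.Unary.All as All
open import Data.List.Relation.Unary.All.Properties using (++⁺; map⁺)
open import Data.Maybe using (Maybe; just; nothing)
open import Data.Product using (Σ; _×_; _,_; proj₂)
open import Data.Sum using (_⊎_; inj₁; inj₂)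
open import Data.Empty using (⊥; ⊥-elim)
open import Relation.Nullary using (¬_; yes; no; Dec)
open import Relation.Binary.PropositionalEquality
open import Algebra.Properties.CommutativeSemigroup +-commutativeSemigroup using (interchange)
open import Data.Integer using (ℤ; +_)
import Data.Integer as ℤ
import Data.Integer.Properties as ℤ
import Data.Integer.Tactic.RingSolver as ℤ-Solver
open import Data.Rational using (ℚ)
import Data.Rational as ℚ
open import Data.Rational.Unnormalised using (mkℚᵘ; *≡*)
import Data.Rational.Unnormalised.Properties as ℚᵘ
open import Data.Rational.Properties
  using (fromℚᵘ-cong; toℚᵘ-injective; toℚᵘ-fromℚᵘ; toℚᵘ-homo-+; toℚᵘ-homo-*; toℚᵘ-homo‿-)

Σ∈ : {A : Set} → List A → (A → ℕ) → ℕ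
Σ∈ [] f = 0
Σ∈ (x ∷ xs) f = f x + Σ∈ xs f

Σ< : ℕ → (ℕ → ℕ) → ℕ
Σ< zero h = 0
Σ< (suc n) h = h 0 + Σ< n (λ t → h (suc t))

𝟙 : Bool → ℕ
𝟙 true = 1
𝟙 false = 0

module _ {A : Set} where

  Σ∈-cong : (xs : List A) {f g : A → ℕ} → (∀ x → f x ≡ g x) → Σ∈ xs f ≡ Σ∈ xs g
  Σ∈-cong [] e = refl
  Σ∈-cong (x ∷ xs) e = cong₂ _+_ (e x) (Σ∈-cong xs e)

  Σ∈-zero : (xs : List A) → Σ∈ xs (λ _ → 0) ≡ 0
  Σ∈-zero [] = refl
  Σ∈-zero (x ∷ xs) = Σ∈-zero xs

  Σ∈-++ : (xs ys : List A) (f : A → ℕ) → Σ∈ (xs ++ ys) f ≡ Σ∈ xs f + Σ∈ ys f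
  Σ∈-++ [] ys f = refl
  Σ∈-++ (x ∷ xs) ys f = trans (cong (_+_ (f x)) (Σ∈-++ xs ys f)) (sym (+-assoc (f x) _ _))

  Σ∈-filterᵇ : (p : A → Bool) (xs : List A) (f : A → ℕ) →
               Σ∈ (filterᵇ p xs) f ≡ Σ∈ xs (λ x → if p x then f x else 0)
  Σ∈-filterᵇ p [] f = refl
  Σ∈-filterᵇ p (x ∷ xs) f with p x
  ... | true = cong (_+_ (f x)) (Σ∈-filterᵇ p xs f)
  ... | false = Σ∈-filterᵇ p xs f

  length-filterᵇ : (p : A → Bool) (xs : List A) → length (filterᵇ p xs) ≡ Σ∈ xs (λ x → 𝟙 (p x))
  length-filterᵇ p [] = refl
  length-filterᵇ p (x ∷ xs) with p x
  ... | true = cong suc (length-filterᵇ p xs)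
  ... | false = length-filterᵇ p xs

  Σ∈-applyUpTo : (h : ℕ → A) (n : ℕ) (f : A → ℕ) → Σ∈ (applyUpTo h n) f ≡ Σ< n (λ t → f (h t))
  Σ∈-applyUpTo h zero f = refl
  Σ∈-applyUpTo h (suc n) f = cong (_+_ (f (h 0))) (Σ∈-applyUpTo (λ t → h (suc t)) n f)

  Σ∈-if : ∀ (xs : List A) b (f : A → ℕ) → Σ∈ xs (λ x → if b then f x else 0) ≡ (if b then Σ∈ xs f else 0)
  Σ∈-if xs true f = refl
  Σ∈-if xs false f = Σ∈-zero xs

Σ∈-map : {A B : Set} (g : A → B) (xs : List A) (f : B → ℕ) → Σ∈ (map g xs) f ≡ Σ∈ xs (λ x → f (g x))
Σ∈-map g [] f = refl
Σ∈-map g (x ∷ xs) f = cong (_+_ (f (g x))) (Σ∈-map g xs f)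

Σ∈-concatMap : {A B : Set} (g : A → List B) (xs : List A) (f : B → ℕ) →
               Σ∈ (concatMap g xs) f ≡ Σ∈ xs (λ x → Σ∈ (g x) f)
Σ∈-concatMap g [] f = refl
Σ∈-concatMap g (x ∷ xs) f =
  trans (Σ∈-++ (g x) (concat (map g xs)) f) (cong (_+_ (Σ∈ (g x) f)) (Σ∈-concatMap g xs f))

Σ<-cong-local : (n : ℕ) {h h′ : ℕ → ℕ} → (∀ t → t < n → h t ≡ h′ t) → Σ< n h ≡ Σ< n h′
Σ<-cong-local zero e = refl
Σ<-cong-local (suc n) e = cong₂ _+_ (e 0 z<s) (Σ<-cong-local n (λ t lt → e (suc t) (s<s lt)))

Σ<-cong : (n : ℕ) {h h′ : ℕ → ℕ} → (∀ t → h t ≡ h′ t) → Σ< n h ≡ Σ< n h′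
Σ<-cong n e = Σ<-cong-local n (λ t _ → e t)

Σ<-zero : (n : ℕ) → Σ< n (λ _ → 0) ≡ 0
Σ<-zero zero = refl
Σ<-zero (suc n) = Σ<-zero n

Σ<-one : (n : ℕ) → Σ< n (λ _ → 1) ≡ n
Σ<-one zero = refl
Σ<-one (suc n) = cong suc (Σ<-one n)

Σ<-+ : (n : ℕ) (a b : ℕ → ℕ) → Σ< n (λ t → a t + b t) ≡ Σ< n a + Σ< n b
Σ<-+ zero a b = refl
Σ<-+ (suc n) a b =
  trans (cong (_+_ (a 0 + b 0)) (Σ<-+ n (λ t → a (suc t)) (λ t → b (suc t)))) (interchange (a 0) (b 0) _ _)

Σ<-suc : (m : ℕ) (h : ℕ → ℕ) → Σ< (suc m) h ≡ Σ< m h + h m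
Σ<-suc zero h = +-identityʳ (h 0)
Σ<-suc (suc m) h = trans (cong (_+_ (h 0)) (Σ<-suc m (λ t → h (suc t)))) (sym (+-assoc (h 0) _ _))

Σ<-last : (m : ℕ) (h : ℕ → ℕ) → (∀ t → t < m → h t ≡ 0) → Σ< (suc m) h ≡ h m
Σ<-last m h z = trans (Σ<-suc m h) (cong (_+ h m) (trans (Σ<-cong-local m z) (Σ<-zero m)))

Σ∈-Σ<-comm : {A : Set} (xs : List A) (m : ℕ) (h : A → ℕ → ℕ) →
             Σ∈ xs (λ x → Σ< m (h x)) ≡ Σ< m (λ t → Σ∈ xs (λ x → h x t))
Σ∈-Σ<-comm [] m h = sym (Σ<-zero m)
Σ∈-Σ<-comm (x ∷ xs) m h =
  trans (cong (_+_ (Σ< m (h x))) (Σ∈-Σ<-comm xs m h)) (sym (Σ<-+ m (h x) (λ t → Σ∈ xs (λ y → h y t))))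

true≢false : true ≢ false
true≢false ()

∧-true : ∀ {a b} → a ≡ true → b ≡ true → a ∧ b ≡ true
∧-true refl refl = refl

∨-true⁻ : ∀ {a b} → a ∨ b ≡ true → a ≡ true ⊎ b ≡ true
∨-true⁻ {true} e = inj₁ refl
∨-true⁻ {false} e = inj₂ e

∨-trueˡ : ∀ {a b} → a ≡ true → a ∨ b ≡ true
∨-trueˡ refl = refl

∨-trueʳ : ∀ {a b} → b ≡ true → a ∨ b ≡ true
∨-trueʳ {true} e = refl
∨-trueʳ {false} e = e

not-true⁻ : ∀ {a} → not a ≡ true → a ≡ false
not-true⁻ {false} e = refl

≢true⇒≡false : ∀ {b} → b ≢ true → b ≡ false
≢true⇒≡false = ¬-not

≢false⇒≡true : ∀ {b} → b ≢ false → b ≡ true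
≢false⇒≡true = ¬-not

≡-by-truth : ∀ {a b} → (a ≡ true → b ≡ true) → (b ≡ true → a ≡ true) → a ≡ b
≡-by-truth {true} {true} f g = refl
≡-by-truth {true} {false} f g = sym (f refl)
≡-by-truth {false} {true} f g = g refl
≡-by-truth {false} {false} f g = refl

if-false : ∀ {A : Set} {b} {x y : A} → b ≡ false → (if b then x else y) ≡ y
if-false refl = refl

if-true : ∀ {A : Set} {b} {x y : A} → b ≡ true → (if b then x else y) ≡ x
if-true refl = refl

<ᵇ-true : ∀ {m n} → m < n → (m <ᵇ n) ≡ true
<ᵇ-true {zero} {suc n} _ = refl
<ᵇ-true {suc m} {suc n} (s<s p) = <ᵇ-true p

<ᵇ-false : ∀ {m n} → n ≤ m → (m <ᵇ n) ≡ false
<ᵇ-false {m} {zero} _ = refl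
<ᵇ-false {suc m} {suc n} (s≤s p) = <ᵇ-false p

<ᵇ-true⁻ : ∀ m n → (m <ᵇ n) ≡ true → m < n
<ᵇ-true⁻ m n e = <ᵇ⇒< m n (subst T (sym e) _)

<ᵇ-false⁻ : ∀ m n → (m <ᵇ n) ≡ false → n ≤ m
<ᵇ-false⁻ m n e = ≮⇒≥ (λ m<n → true≢false (trans (sym (<ᵇ-true m<n)) e))

≡ᵇ-refl : ∀ m → (m ≡ᵇ m) ≡ true
≡ᵇ-refl zero = refl
≡ᵇ-refl (suc m) = ≡ᵇ-refl m

≡ᵇ-false : ∀ {m n} → m ≢ n → (m ≡ᵇ n) ≡ false
≡ᵇ-false {zero} {zero} h = ⊥-elim (h refl)
≡ᵇ-false {zero} {suc n} h = refl
≡ᵇ-false {suc m} {zero} h = refl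
≡ᵇ-false {suc m} {suc n} h = ≡ᵇ-false (λ e → h (cong suc e))

≡ᵇ-true⁻ : ∀ m n → (m ≡ᵇ n) ≡ true → m ≡ n
≡ᵇ-true⁻ m n e = ≡ᵇ⇒≡ m n (subst T (sym e) _)

≤ᵇ-true : ∀ {m n} → m ≤ n → (m ≤ᵇ n) ≡ true
≤ᵇ-true {zero} _ = refl
≤ᵇ-true {suc m} p = <ᵇ-true p

≤ᵇ-false : ∀ {m n} → n < m → (m ≤ᵇ n) ≡ false
≤ᵇ-false {suc m} (s≤s p) = <ᵇ-false p

all-applyUpTo : ∀ {P : ℕ → Bool} (h : ℕ → ℕ) n → (∀ t → t < n → P (h t) ≡ true) → all P (applyUpTo h n) ≡ true
all-applyUpTo h zero f = refl
all-applyUpTo {P} h (suc n) f =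
  ∧-true (f 0 z<s) (all-applyUpTo {P} (λ t → h (suc t)) n (λ t lt → f (suc t) (s<s lt)))

all-applyUpTo⁻ : ∀ {P : ℕ → Bool} (h : ℕ → ℕ) n → all P (applyUpTo h n) ≡ true → ∀ t → t < n → P (h t) ≡ true
all-applyUpTo⁻ h (suc n) e zero lt = ∧-conicalˡ _ _ e
all-applyUpTo⁻ {P} h (suc n) e (suc t) (s<s lt) = all-applyUpTo⁻ {P} (λ t → h (suc t)) n (∧-conicalʳ _ _ e) t lt

any-applyUpTo : ∀ {P : ℕ → Bool} (h : ℕ → ℕ) n t → t < n → P (h t) ≡ true → any P (applyUpTo h n) ≡ true
any-applyUpTo h (suc n) zero lt e = ∨-trueˡ e
any-applyUpTo {P} h (suc n) (suc t) (s<s lt) e = ∨-trueʳ {P (h 0)} (any-applyUpTo {P} (λ t → h (suc t)) n t lt e)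

any-applyUpTo⁻ : ∀ {P : ℕ → Bool} (h : ℕ → ℕ) n → any P (applyUpTo h n) ≡ true → Σ ℕ (λ t → t < n × P (h t) ≡ true)
any-applyUpTo⁻ {P} h (suc n) e with ∨-true⁻ {P (h 0)} e
... | inj₁ e′ = 0 , z<s , e′
... | inj₂ e′ with any-applyUpTo⁻ {P} (λ t → h (suc t)) n e′
... | t , lt , e″ = suc t , s<s lt , e″

range-offset< : ∀ a b t → a ≤ t → t ≤ b → t ∸ a < suc b ∸ a
range-offset< a b t p q = ∸-monoˡ-< (s≤s q) p

range-bound : ∀ a b t → t < suc b ∸ a → a + t ≤ b
range-bound a b t lt = ≤-pred (subst (suc (a + t) ≤_) (m+[n∸m]≡n a≤sb) (+-monoʳ-< a lt))
  where
  a≤sb : a ≤ suc b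
  a≤sb with a ≤? suc b
  ... | yes p = p
  ... | no p = ⊥-elim (<⇒≱ lt (subst (_≤ t) (sym (m≤n⇒m∸n≡0 (≰⇒≥ p))) z≤n))

all-range : ∀ {P : ℕ → Bool} a b → (∀ t → a ≤ t → t ≤ b → P t ≡ true) → all P (range a b) ≡ true
all-range {P} a b f =
  all-applyUpTo {P} (λ t → a + t) (suc b ∸ a) (λ t lt → f (a + t) (m≤m+n a t) (range-bound a b t lt))

all-range⁻ : ∀ {P : ℕ → Bool} a b → all P (range a b) ≡ true → ∀ t → a ≤ t → t ≤ b → P t ≡ true
all-range⁻ {P} a b e t p q =
  subst (λ x → P x ≡ true) (m+[n∸m]≡n p)
    (all-applyUpTo⁻ {P} (λ t → a + t) (suc b ∸ a) e (t ∸ a) (range-offset< a b t p q))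

any-range : ∀ {P : ℕ → Bool} a b t → a ≤ t → t ≤ b → P t ≡ true → any P (range a b) ≡ true
any-range {P} a b t p q e =
  any-applyUpTo {P} (λ t → a + t) (suc b ∸ a) (t ∸ a) (range-offset< a b t p q)
    (subst (λ x → P x ≡ true) (sym (m+[n∸m]≡n p)) e)

any-range⁻ : ∀ {P : ℕ → Bool} a b → any P (range a b) ≡ true → Σ ℕ (λ t → a ≤ t × t ≤ b × P t ≡ true)
any-range⁻ {P} a b e with any-applyUpTo⁻ {P} (λ t → a + t) (suc b ∸ a) e
... | t , lt , e′ = a + t , m≤m+n a t , range-bound a b t lt , e′

any-range-false : ∀ {P : ℕ → Bool} a b → (∀ t → a ≤ t → t ≤ b → P t ≡ false) → any P (range a b) ≡ false
any-range-false {P} a b f =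
  ≢true⇒≡false (λ e → let (t , p , q , e′) = any-range⁻ {P} a b e in true≢false (trans (sym e′) (f t p q)))

all-range-false : ∀ {P : ℕ → Bool} a b t → a ≤ t → t ≤ b → P t ≡ false → all P (range a b) ≡ false
all-range-false {P} a b t p q e = ≢true⇒≡false (λ e′ → true≢false (trans (sym (all-range⁻ {P} a b e′ t p q)) e))

all-range-false⁻ : ∀ {P : ℕ → Bool} a b → all P (range a b) ≡ false → Σ ℕ (λ t → a ≤ t × t ≤ b × P t ≡ false)
all-range-false⁻ {P} a b e with any-range⁻ {λ t → not (P t)} a b (all-false⇒any-not (range a b) e)
  where
  all-false⇒any-not : ∀ xs → all P xs ≡ false → any (λ t → not (P t)) xs ≡ true
  all-false⇒any-not (x ∷ xs) e with P x
  ... | true = all-false⇒any-not xs e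
  ... | false = refl
... | t , p , q , r = t , p , q , not-true⁻ r

all-range-cong : ∀ {P Q : ℕ → Bool} a b → (∀ t → a ≤ t → t ≤ b → P t ≡ Q t) → all P (range a b) ≡ all Q (range a b)
all-range-cong {P} {Q} a b f =
  ≡-by-truth (λ e → all-range {Q} a b (λ t p q → trans (sym (f t p q)) (all-range⁻ {P} a b e t p q)))
             (λ e → all-range {P} a b (λ t p q → trans (f t p q) (all-range⁻ {Q} a b e t p q)))

coversRange : ℕ → List ℕ → Bool
coversRange N w = all (λ v → elemᵇ v w) (range 1 N)

shiftFrom : ℕ → ℕ → ℕ
shiftFrom v x = if x <ᵇ v then x else suc x

extend : List ℕ → ℕ → List ℕ
extend p v = map (shiftFrom v) p ++ v ∷ []

grownPerms : ℕ → List (List ℕ)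
grownPerms zero = [] ∷ []
grownPerms (suc n) = concatMap (λ p → map (extend p) (range 1 (suc n))) (grownPerms n)

shiftFrom-≥ : ∀ {v s} → v ≤ s → shiftFrom v s ≡ suc s
shiftFrom-≥ p rewrite <ᵇ-false p = refl

shiftFrom-< : ∀ {v s} → s < v → shiftFrom v s ≡ s
shiftFrom-< p rewrite <ᵇ-true p = refl

≤shiftFrom : ∀ v x → x ≤ shiftFrom v x
≤shiftFrom v x with x <ᵇ v
... | true = ≤-refl
... | false = n≤1+n x

shiftFrom≤suc : ∀ v x → shiftFrom v x ≤ suc x
shiftFrom≤suc v x with x <ᵇ v
... | true = n≤1+n x
... | false = ≤-refl

shiftFrom-suc : ∀ v x → shiftFrom (suc v) (suc x) ≡ suc (shiftFrom v x)
shiftFrom-suc v x = sym (if-float suc (x <ᵇ v))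

shiftFrom-≡ᵇ : ∀ v x y → (shiftFrom v y ≡ᵇ shiftFrom v x) ≡ (y ≡ᵇ x)
shiftFrom-≡ᵇ v x y with x <ᵇ v in x<v | y <ᵇ v in y<v
... | true | true = refl
... | false | false = refl
... | true | false = trans (≡ᵇ-false (λ e → <⇒≱ x<v′ (subst (v ≤_) e (≤-trans v≤y (n≤1+n y)))))
                           (sym (≡ᵇ-false (λ e → <⇒≱ x<v′ (subst (v ≤_) e v≤y))))
  where
  x<v′ = <ᵇ-true⁻ x v x<v
  v≤y = <ᵇ-false⁻ y v y<v
... | false | true = trans (≡ᵇ-false (λ e → <⇒≱ y<v′ (subst (v ≤_) (sym e) (≤-trans v≤x (n≤1+n x)))))
                           (sym (≡ᵇ-false (λ e → <⇒≱ y<v′ (subst (v ≤_) (sym e) v≤x))))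
  where
  y<v′ = <ᵇ-true⁻ y v y<v
  v≤x = <ᵇ-false⁻ x v x<v

shiftFrom≢gap : ∀ v y → shiftFrom v y ≢ v
shiftFrom≢gap v y with y <ᵇ v in y<v
... | true = λ e → <-irrefl e (<ᵇ-true⁻ y v y<v)
... | false = λ e → <-irrefl (sym e) (s≤s (<ᵇ-false⁻ y v y<v))

Σ∈-grownPerms-suc : ∀ n F → Σ∈ (grownPerms (suc n)) F ≡ Σ∈ (grownPerms n) (λ p → Σ< (suc n) (λ t → F (extend p (suc t))))
Σ∈-grownPerms-suc n F =
  trans (Σ∈-concatMap _ (grownPerms n) F)
        (Σ∈-cong (grownPerms n) (λ p → trans (Σ∈-map (extend p) (range 1 (suc n)) F)
                                            (Σ∈-applyUpTo (λ t → 1 + t) (suc n) (λ v → F (extend p v)))))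

Σ∈-words-suc : ∀ m n F → Σ∈ (words m (suc n)) F ≡ Σ< m (λ t → Σ∈ (words m n) (λ w → F (suc t ∷ w)))
Σ∈-words-suc m n F =
  trans (Σ∈-concatMap _ (range 1 m) F)
        (trans (Σ∈-applyUpTo (λ t → 1 + t) m _) (Σ<-cong m (λ t → Σ∈-map (suc t ∷_) (words m n) F)))

Σ∈-words-cong : ∀ m n {f g : List ℕ → ℕ} → (∀ u → length u ≡ n → f u ≡ g u) → Σ∈ (words m n) f ≡ Σ∈ (words m n) g
Σ∈-words-cong m zero e = cong (_+ 0) (e [] refl)
Σ∈-words-cong m (suc n) {f} {g} e =
  trans (Σ∈-words-suc m n f)
        (trans (Σ<-cong m (λ t → Σ∈-words-cong m n (λ u lu → e (suc t ∷ u) (cong suc lu)))) (sym (Σ∈-words-suc m n g)))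

Σ∈-words-snoc : ∀ m n F → Σ∈ (words m (suc n)) F ≡ Σ∈ (words m n) (λ u → Σ< m (λ t → F (u ++ suc t ∷ [])))
Σ∈-words-snoc m zero F = trans (Σ∈-words-suc m 0 F) (trans (Σ<-cong m (λ t → +-identityʳ _)) (sym (+-identityʳ _)))
Σ∈-words-snoc m (suc n) F =
  trans (Σ∈-words-suc m (suc n) F)
        (trans (Σ<-cong m (λ t → Σ∈-words-snoc m n (λ w → F (suc t ∷ w)))) (sym (Σ∈-words-suc m n _)))

elemᵇ-++ : ∀ v xs ys → elemᵇ v (xs ++ ys) ≡ (elemᵇ v xs ∨ elemᵇ v ys)
elemᵇ-++ v [] ys = refl
elemᵇ-++ v (x ∷ xs) ys with x ≡ᵇ v
... | true = refl
... | false = elemᵇ-++ v xs ys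

elemᵇ-map-shiftFrom : ∀ v x p → elemᵇ (shiftFrom v x) (map (shiftFrom v) p) ≡ elemᵇ x p
elemᵇ-map-shiftFrom v x [] = refl
elemᵇ-map-shiftFrom v x (y ∷ p) = cong₂ _∨_ (shiftFrom-≡ᵇ v x y) (elemᵇ-map-shiftFrom v x p)

elemᵇ-singleton : ∀ t v → t ≢ v → elemᵇ t (v ∷ []) ≡ false
elemᵇ-singleton t v t≢v = cong (_∨ false) (≡ᵇ-false (λ e → t≢v (sym e)))

remove : ℕ → List ℕ → List ℕ
remove x = filterᵇ (λ y → not (y ≡ᵇ x))

elemᵇ-remove : ∀ x t u → t ≢ x → elemᵇ t u ≡ true → elemᵇ t (remove x u) ≡ true
elemᵇ-remove x t (y ∷ u) t≢x t∈yu with y ≡ᵇ x in y≟x | ∨-true⁻ {y ≡ᵇ t} t∈yu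
... | true | inj₁ y≡t = ⊥-elim (t≢x (trans (sym (≡ᵇ-true⁻ y t y≡t)) (≡ᵇ-true⁻ y x y≟x)))
... | true | inj₂ t∈u = elemᵇ-remove x t u t≢x t∈u
... | false | inj₁ y≡t = ∨-trueˡ y≡t
... | false | inj₂ t∈u = ∨-trueʳ {y ≡ᵇ t} (elemᵇ-remove x t u t≢x t∈u)

length-remove≤ : ∀ x u → length (remove x u) ≤ length u
length-remove≤ x [] = z≤n
length-remove≤ x (y ∷ u) with y ≡ᵇ x
... | true = ≤-trans (length-remove≤ x u) (n≤1+n _)
... | false = s≤s (length-remove≤ x u)

length-remove< : ∀ x u → elemᵇ x u ≡ true → length (remove x u) < length u
length-remove< x (y ∷ u) x∈yu with y ≡ᵇ x
... | true = s≤s (length-remove≤ x u)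
... | false = s≤s (length-remove< x u x∈yu)

covered⇒≤length : ∀ m u → (∀ t → 1 ≤ t → t ≤ m → elemᵇ t u ≡ true) → m ≤ length u
covered⇒≤length zero u covered = z≤n
covered⇒≤length (suc m) u covered =
  ≤-trans (s≤s (covered⇒≤length m (remove (suc m) u) still-covered))
      (length-remove< (suc m) u (covered (suc m) (s≤s z≤n) ≤-refl))
  where
  still-covered : ∀ t → 1 ≤ t → t ≤ m → elemᵇ t (remove (suc m) u) ≡ true
  still-covered t 1≤t t≤m = elemᵇ-remove (suc m) t u (λ e → <-irrefl e (s≤s t≤m)) (covered t 1≤t (≤-trans t≤m (n≤1+n m)))

covers-snoc⇒fresh : ∀ n u v → length u ≡ n → coversRange (suc n) (u ++ v ∷ []) ≡ true → elemᵇ v u ≡ false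
covers-snoc⇒fresh n u v |u|≡n covers =
  ≢true⇒≡false λ v∈u → <-irrefl (sym |u|≡n) (covered⇒≤length (suc n) u (λ t 1≤t t≤n → covered t 1≤t t≤n v∈u))
  where
  covered : ∀ t → 1 ≤ t → t ≤ suc n → elemᵇ v u ≡ true → elemᵇ t u ≡ true
  covered t 1≤t t≤n v∈u
    with ∨-true⁻ (trans (sym (elemᵇ-++ t u (v ∷ []))) (all-range⁻ {λ s → elemᵇ s (u ++ v ∷ [])} 1 (suc n) covers t 1≤t t≤n))
  ... | inj₁ t∈u = t∈u
  ... | inj₂ t∈[v] = subst (λ z → elemᵇ z u ≡ true) (≡ᵇ-true⁻ v t (trans (sym (∨-identityʳ (v ≡ᵇ t))) t∈[v])) v∈u

Σ<-skip : ∀ n w (H : ℕ → ℕ) → w ≤ n →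
          Σ< (suc n) (λ t → if not (suc t ≡ᵇ suc w) then H (suc t) else 0) ≡ Σ< n (λ t → H (shiftFrom (suc w) (suc t)))
Σ<-skip n zero H _ = refl
Σ<-skip (suc n) (suc w) H (s≤s w≤n) =
  cong (_+_ (H 1)) (trans (Σ<-skip n w (λ x → H (suc x)) w≤n)
      (Σ<-cong n (λ t → cong H (sym (shiftFrom-suc (suc w) (suc t))))))

if-not-∨ : ∀ a b (X : ℕ) → (if not (a ∨ b) then X else 0) ≡ (if not b then (if not a then X else 0) else 0)
if-not-∨ true true X = refl
if-not-∨ true false X = refl
if-not-∨ false true X = refl
if-not-∨ false false X = refl

Σ∈-words-avoiding : ∀ n w len (G : List ℕ → ℕ) → w ≤ n →
  Σ∈ (words (suc n) len) (λ u → if not (elemᵇ (suc w) u) then G u else 0) ≡ Σ∈ (words n len)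
      (λ p → G (map (shiftFrom (suc w)) p))
Σ∈-words-avoiding n w zero G w≤n = refl
Σ∈-words-avoiding n w (suc len) G w≤n =
  trans (Σ∈-words-suc (suc n) len _)
  (trans (Σ<-cong (suc n) (λ t → Σ∈-cong (words (suc n) len)
      (λ u → if-not-∨ (suc t ≡ᵇ suc w) (elemᵇ (suc w) u) (G (suc t ∷ u)))))
  (trans (Σ<-cong (suc n) (λ t → Σ∈-words-avoiding n w len (λ u → if not (suc t ≡ᵇ suc w) then G (suc t ∷ u) else 0) w≤n))
  (trans (Σ<-cong (suc n) (λ t → Σ∈-if (words n len) (not (suc t ≡ᵇ suc w)) (λ q → G (suc t ∷ map (shiftFrom (suc w)) q))))
  (trans (Σ<-skip n w (λ x → Σ∈ (words n len) (λ q → G (x ∷ map (shiftFrom (suc w)) q))) w≤n)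
  (sym (Σ∈-words-suc n len _))))))

coversRange-extend : ∀ n w p → w ≤ n → coversRange (suc n) (map (shiftFrom (suc w)) p ++ suc w ∷ []) ≡ coversRange n p
coversRange-extend n w p w≤n = ≡-by-truth restrict-cover extend-cover
  where
  v = suc w
  restrict-cover : coversRange (suc n) (map (shiftFrom v) p ++ v ∷ []) ≡ true → coversRange n p ≡ true
  restrict-cover covers = all-range {λ s → elemᵇ s p} 1 n λ s 1≤s s≤n →
    let t = shiftFrom v s
        t∈ = all-range⁻ {λ s → elemᵇ s (map (shiftFrom v) p ++ v ∷ [])} 1 (suc n) covers t
               (≤-trans 1≤s (≤shiftFrom v s)) (≤-trans (shiftFrom≤suc v s) (s≤s s≤n))
        t∈shifted : elemᵇ t (map (shiftFrom v) p) ≡ true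
        t∈shifted = trans (sym (∨-identityʳ _))
                          (subst (λ b → (elemᵇ t (map (shiftFrom v) p) ∨ b) ≡ true) (elemᵇ-singleton t v (shiftFrom≢gap v s))
                                 (trans (sym (elemᵇ-++ t (map (shiftFrom v) p) (v ∷ []))) t∈))
    in trans (sym (elemᵇ-map-shiftFrom v s p)) t∈shifted
  extend-cover : coversRange n p ≡ true → coversRange (suc n) (map (shiftFrom v) p ++ v ∷ []) ≡ true
  extend-cover covers = all-range {λ s → elemᵇ s (map (shiftFrom v) p ++ v ∷ [])} 1 (suc n) covered
    where
    shifted : ∀ s t → 1 ≤ s → s ≤ n → shiftFrom v s ≡ t → elemᵇ t (map (shiftFrom v) p ++ v ∷ []) ≡ true
    shifted s t 1≤s s≤n refl = trans (elemᵇ-++ t (map (shiftFrom v) p) (v ∷ []))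
      (∨-trueˡ (trans (elemᵇ-map-shiftFrom v s p) (all-range⁻ {λ s → elemᵇ s p} 1 n covers s 1≤s s≤n)))
    covered : ∀ t → 1 ≤ t → t ≤ suc n → elemᵇ t (map (shiftFrom v) p ++ v ∷ []) ≡ true
    covered t 1≤t t≤n with t ≟ v | t <? v
    ... | yes refl | _ = trans (elemᵇ-++ v (map (shiftFrom v) p) (v ∷ []))
        (∨-trueʳ {elemᵇ v (map (shiftFrom v) p)} (∨-trueˡ (≡ᵇ-refl v)))
    ... | no _ | yes t<v = shifted t t 1≤t (≤-pred (≤-trans t<v (s≤s w≤n))) (shiftFrom-< t<v)
    covered (suc s) 1≤t (s≤s s≤n) | no t≢v | no t≮v =
      shifted s (suc s) (≤-trans (s≤s z≤n) v≤s) s≤n (shiftFrom-≥ v≤s)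
      where
      v≤s : v ≤ s
      v≤s = ≤-pred (≤∧≢⇒< (≮⇒≥ t≮v) (λ e → t≢v (sym e)))

Σ∈-perms≡Σ∈-grownPerms : ∀ n (f : List ℕ → ℕ) → Σ∈ (perms n) f ≡ Σ∈ (grownPerms n) f
Σ∈-perms≡Σ∈-grownPerms zero f = refl
Σ∈-perms≡Σ∈-grownPerms (suc n) f =
  trans (Σ∈-filterᵇ (coversRange (suc n)) (words (suc n) (suc n)) f)
  (trans (Σ∈-words-snoc (suc n) n _)
  (trans (Σ∈-Σ<-comm (words (suc n) n) (suc n) (λ u t → summand t u))
  (trans (Σ<-cong-local (suc n) (λ t _ → Σ∈-words-cong (suc n) n (λ u |u|≡n → summand-fresh t u |u|≡n)))
  (trans (Σ<-cong-local (suc n) (λ t t≤n → Σ∈-words-avoiding n t n (summand t) (≤-pred t≤n)))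
  (trans (Σ<-cong-local (suc n) (λ t t≤n → Σ∈-cong (words n n)
           (λ p → cong (λ b → if b then f (extend p (suc t)) else 0) (coversRange-extend n t p (≤-pred t≤n)))))
  (trans (Σ<-cong (suc n) (λ t → sym (Σ∈-filterᵇ (coversRange n) (words n n) (λ p → f (extend p (suc t))))))
  (trans (Σ<-cong (suc n) (λ t → Σ∈-perms≡Σ∈-grownPerms n (λ p → f (extend p (suc t)))))
  (trans (sym (Σ∈-Σ<-comm (grownPerms n) (suc n) (λ p t → f (extend p (suc t)))))
  (sym (Σ∈-grownPerms-suc n f))))))))))
  where
  summand : ℕ → List ℕ → ℕ
  summand t u = if coversRange (suc n) (u ++ suc t ∷ []) then f (u ++ suc t ∷ []) else 0
  summand-fresh : ∀ t u → length u ≡ n → summand t u ≡ (if not (elemᵇ (suc t) u) then summand t u else 0)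
  summand-fresh t u |u|≡n with elemᵇ (suc t) u in t∈u
  ... | false = refl
  ... | true with coversRange (suc n) (u ++ suc t ∷ []) in covers
  ...   | false = refl
  ...   | true = ⊥-elim (true≢false (trans (sym t∈u) (covers-snoc⇒fresh n u (suc t) |u|≡n covers)))

at-map : ∀ (f : ℕ → ℕ) xs j → f 0 ≡ 0 → at (map f xs) j ≡ f (at xs j)
at-map f [] j e = sym e
at-map f (x ∷ xs) zero e = sym e
at-map f (x ∷ xs) (suc zero) e = refl
at-map f (x ∷ xs) (suc (suc j)) e = at-map f xs (suc j) e

at-zero : ∀ xs → at xs 0 ≡ 0
at-zero [] = refl
at-zero (x ∷ xs) = refl

at-++ˡ : ∀ xs ys j → j ≤ length xs → at (xs ++ ys) j ≡ at xs j
at-++ˡ [] ys zero _ = at-zero ys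
at-++ˡ (x ∷ xs) ys zero _ = refl
at-++ˡ (x ∷ xs) ys (suc zero) _ = refl
at-++ˡ (x ∷ xs) ys (suc (suc j)) (s≤s p) = at-++ˡ xs ys (suc j) p

at-snoc : ∀ xs y → at (xs ++ y ∷ []) (suc (length xs)) ≡ y
at-snoc [] y = refl
at-snoc (x ∷ xs) y = at-snoc xs y

shiftFrom-zero : ∀ {v} → 1 ≤ v → shiftFrom v 0 ≡ 0
shiftFrom-zero {suc v} _ = refl

shiftFrom-<ᵇ : ∀ v x y → (shiftFrom v x <ᵇ shiftFrom v y) ≡ (x <ᵇ y)
shiftFrom-<ᵇ v x y with x <ᵇ v in ex | y <ᵇ v in ey
... | true | true = refl
... | false | false = refl
... | true | false = trans (<ᵇ-true (<-≤-trans (<ᵇ-true⁻ x v ex) (≤-trans (<ᵇ-false⁻ y v ey) (n≤1+n y))))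
    (sym (<ᵇ-true (<-≤-trans (<ᵇ-true⁻ x v ex) (<ᵇ-false⁻ y v ey))))
... | false | true = trans (<ᵇ-false (≤-trans (<⇒≤ (<ᵇ-true⁻ y v ey)) (≤-trans (<ᵇ-false⁻ x v ex) (n≤1+n x))))
    (sym (<ᵇ-false (<⇒≤ (<-≤-trans (<ᵇ-true⁻ y v ey) (<ᵇ-false⁻ x v ex)))))

shiftFrom-mono-< : ∀ v x y → x < y → shiftFrom v x < shiftFrom v y
shiftFrom-mono-< v x y lt = <ᵇ-true⁻ _ _ (trans (shiftFrom-<ᵇ v x y) (<ᵇ-true lt))

shiftFrom-cancel-< : ∀ v x y → shiftFrom v x < shiftFrom v y → x < y
shiftFrom-cancel-< v x y lt = <ᵇ-true⁻ _ _ (trans (sym (shiftFrom-<ᵇ v x y)) (<ᵇ-true lt))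

shiftFrom-injective : ∀ v x y → shiftFrom v x ≡ shiftFrom v y → x ≡ y
shiftFrom-injective v x y e = ≡ᵇ-true⁻ x y
    (trans (sym (shiftFrom-≡ᵇ v y x)) (subst (λ z → (z ≡ᵇ shiftFrom v y) ≡ true) (sym e) (≡ᵇ-refl (shiftFrom v y))))

shiftFrom-onto : ∀ n v w → 1 ≤ v → 1 ≤ w → w ≤ suc n → w ≢ v → v ≤ suc n → Σ ℕ (λ s → 1 ≤ s × s ≤ n × shiftFrom v s ≡ w)
shiftFrom-onto n v w 1≤v 1≤w w≤n w≢v v≤n with w <? v
... | yes w<v = w , 1≤w , ≤-pred (≤-trans w<v v≤n) , shiftFrom-< w<v
shiftFrom-onto n v (suc s) 1≤v _ (s≤s s≤n) w≢v v≤n | no w≮v = s , ≤-trans 1≤v v≤s , s≤n , shiftFrom-≥ v≤s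
  where
  v≤s = ≤-pred (≤∧≢⇒< (≮⇒≥ w≮v) (λ e → w≢v (sym e)))

gap<shiftFrom : ∀ v x → v ≤ x → v < shiftFrom v x
gap<shiftFrom v x p rewrite shiftFrom-≥ p = s≤s p
gap<shiftFrom⁻ : ∀ v x → v < shiftFrom v x → v ≤ x
gap<shiftFrom⁻ v x lt with x <? v
... | yes q = ⊥-elim (<-asym lt (subst (_< v) (sym (shiftFrom-< q)) q))
... | no q = ≮⇒≥ q

data Grown : ℕ → List ℕ → Set where
  root : Grown 0 []
  grow : ∀ {n p} v → Grown n p → 1 ≤ v → v ≤ suc n → Grown (suc n) (extend p v)

record IsPerm (n : ℕ) (q : List ℕ) : Set where
  field
    size : length q ≡ n
    bounded : ∀ j → 1 ≤ j → j ≤ n → 1 ≤ at q j × at q j ≤ n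
    onto : ∀ w → 1 ≤ w → w ≤ n → Σ ℕ (λ j → 1 ≤ j × j ≤ n × at q j ≡ w)
    injective : ∀ i j → 1 ≤ i → i ≤ n → 1 ≤ j → j ≤ n → at q i ≡ at q j → i ≡ j
    entries-bounded : All (λ x → 1 ≤ x × x ≤ n) q

length-extend : ∀ p v → length (extend p v) ≡ suc (length p)
length-extend p v = trans (length-++ (map (shiftFrom v) p)) (trans (+-comm _ 1) (cong suc (length-map (shiftFrom v) p)))

at-extend : ∀ p v j → 1 ≤ v → j ≤ length p → at (extend p v) j ≡ shiftFrom v (at p j)
at-extend p v j pv jl = trans (at-++ˡ (map (shiftFrom v) p) (v ∷ []) j (subst (j ≤_) (sym (length-map (shiftFrom v) p)) jl))
    (at-map (shiftFrom v) p j (shiftFrom-zero pv))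

at-extend-last : ∀ p v → at (extend p v) (suc (length p)) ≡ v
at-extend-last p v = subst (λ l → at (extend p v) (suc l) ≡ v) (length-map (shiftFrom v) p) (at-snoc (map (shiftFrom v) p) v)

Grown⇒IsPerm : ∀ {n q} → Grown n q → IsPerm n q
Grown⇒IsPerm root = record { size = refl ; bounded = λ j p q → ⊥-elim (<⇒≱ p q) ; onto = λ w p q → ⊥-elim (<⇒≱ p q) ;
    injective = λ i j p q _ _ _ → ⊥-elim (<⇒≱ p q) ; entries-bounded = [] }
Grown⇒IsPerm {suc n} (grow {n} {p} v g 1≤v v≤1+n) = record
    { size = size′ ; bounded = bounded′ ; onto = onto′ ; injective = injective′ ; entries-bounded = entries-bounded′ }
  where
  module IH = IsPerm (Grown⇒IsPerm g)
  size′ : length (extend p v) ≡ suc n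
  size′ = trans (length-extend p v) (cong suc IH.size)
  at-shifted : ∀ j → j ≤ n → at (extend p v) j ≡ shiftFrom v (at p j)
  at-shifted j jn = at-extend p v j 1≤v (subst (j ≤_) (sym IH.size) jn)
  at-last : at (extend p v) (suc n) ≡ v
  at-last = subst (λ l → at (extend p v) (suc l) ≡ v) IH.size (at-extend-last p v)
  bounded′ : ∀ j → 1 ≤ j → j ≤ suc n → 1 ≤ at (extend p v) j × at (extend p v) j ≤ suc n
  bounded′ j p1 pn with m≤n⇒m<n∨m≡n pn
  ... | inj₂ refl = subst (λ x → 1 ≤ x × x ≤ suc n) (sym at-last) (1≤v , v≤1+n)
  ... | inj₁ lt = let (a , b) = IH.bounded j p1 (≤-pred lt) in subst (λ x → 1 ≤ x × x ≤ suc n) (sym (at-shifted j (≤-pred lt)))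
                        (≤-trans a (≤shiftFrom v _) , ≤-trans (shiftFrom≤suc v _) (s≤s b))
  onto′ : ∀ w → 1 ≤ w → w ≤ suc n → Σ ℕ (λ j → 1 ≤ j × j ≤ suc n × at (extend p v) j ≡ w)
  onto′ w p1 pn with w ≟ v
  ... | yes refl = suc n , s≤s z≤n , ≤-refl , at-last
  ... | no ne = let (s , s1 , sn , se) = shiftFrom-onto n v w 1≤v p1 pn ne v≤1+n
                    (j , j1 , jn , je) = IH.onto s s1 sn
                in j , j1 , ≤-trans jn (n≤1+n n) , trans (at-shifted j jn) (trans (cong (shiftFrom v) je) se)
  injective′ : ∀ i j → 1 ≤ i → i ≤ suc n → 1 ≤ j → j ≤ suc n → at (extend p v) i ≡ at (extend p v) j → i ≡ j
  injective′ i j i1 in' j1 jn eq with m≤n⇒m<n∨m≡n in' | m≤n⇒m<n∨m≡n jn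
  ... | inj₂ refl | inj₂ refl = refl
  ... | inj₁ lt | inj₂ refl = ⊥-elim (shiftFrom≢gap v (at p i) (trans (sym (at-shifted i (≤-pred lt))) (trans eq at-last)))
  ... | inj₂ refl | inj₁ lt = ⊥-elim (shiftFrom≢gap v (at p j) (trans (sym (at-shifted j (≤-pred lt))) (trans (sym eq) at-last)))
  ... | inj₁ lt | inj₁ lt' = IH.injective i j i1 (≤-pred lt) j1 (≤-pred lt')
      (shiftFrom-injective v _ _ (trans (sym (at-shifted i (≤-pred lt))) (trans eq (at-shifted j (≤-pred lt')))))
  entries-bounded′ : All (λ x → 1 ≤ x × x ≤ suc n) (extend p v)
  entries-bounded′ = ++⁺ (map⁺ (All.map (λ {x} (a , b) → ≤-trans a (≤shiftFrom v x) , ≤-trans (shiftFrom≤suc v x) (s≤s b))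
      IH.entries-bounded)) ((1≤v , v≤1+n) ∷ [])

countBelow : ℕ → List ℕ → ℕ
countBelow x xs = length (filterᵇ (λ y → y <ᵇ x) xs)

countBelow-map : ∀ (f : ℕ → ℕ) → (∀ x y → (f y <ᵇ f x) ≡ (y <ᵇ x)) → ∀ x xs → countBelow (f x) (map f xs) ≡ countBelow x xs
countBelow-map f mono x xs = trans (length-filterᵇ _ (map f xs))
    (trans (Σ∈-map f xs _) (trans (Σ∈-cong xs (λ y → cong 𝟙 (mono x y))) (sym (length-filterᵇ _ xs))))

std-map-monotone : ∀ (f : ℕ → ℕ) → (∀ x y → (f y <ᵇ f x) ≡ (y <ᵇ x)) → ∀ xs → std (map f xs) ≡ std xs
std-map-monotone f mono xs = trans (sym (map-∘ xs)) (map-cong (λ x → cong suc (countBelow-map f mono x xs)) xs)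

take-++ˡ : ∀ j (xs ys : List ℕ) → j ≤ length xs → take j (xs ++ ys) ≡ take j xs
take-++ˡ zero xs ys _ = refl
take-++ˡ (suc j) (x ∷ xs) ys (s≤s p) = cong (x ∷_) (take-++ˡ j xs ys p)

restrict-extend : ∀ p v j → j ≤ length p → restrict (extend p v) j ≡ restrict p j
restrict-extend p v j jl = trans (cong std
    (trans (take-++ˡ j (map (shiftFrom v) p) (v ∷ []) (subst (j ≤_) (sym (length-map (shiftFrom v) p)) jl)) (take-map j p)))
    (std-map-monotone (shiftFrom v) (λ x y → shiftFrom-<ᵇ v y x) (take j p))

shiftFrom-<ᵇ-below : ∀ v x y → x ≤ v → (shiftFrom v y <ᵇ x) ≡ (y <ᵇ x)
shiftFrom-<ᵇ-below v x y xv with y <ᵇ v in ey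
... | true = refl
... | false = trans (<ᵇ-false (≤-trans xv (≤-trans (<ᵇ-false⁻ y v ey) (n≤1+n y))))
    (sym (<ᵇ-false (≤-trans xv (<ᵇ-false⁻ y v ey))))

shiftFrom-<ᵇ-above : ∀ v x y → v ≤ x → (shiftFrom v y <ᵇ suc x) ≡ (y <ᵇ x)
shiftFrom-<ᵇ-above v x y vx with y <ᵇ v in ey
... | true = trans (<ᵇ-true (≤-trans (<ᵇ-true⁻ y v ey) (≤-trans vx (n≤1+n x))))
    (sym (<ᵇ-true (<-≤-trans (<ᵇ-true⁻ y v ey) vx)))
... | false = refl

countBelowΣ : ℕ → List ℕ → ℕ
countBelowΣ x q = Σ∈ q (λ y → 𝟙 (y <ᵇ x))

countBelow-grown : ∀ {n q} → Grown n q → ∀ x → x ≤ suc n → countBelowΣ x q ≡ x ∸ 1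
countBelow-grown root zero _ = refl
countBelow-grown root (suc zero) _ = refl
countBelow-grown root (suc (suc x)) (s≤s ())
countBelow-grown {suc n} (grow {n} {p} v g 1≤v v≤n) x x≤n =
  trans (Σ∈-++ (map (shiftFrom v) p) (v ∷ []) _) (trans (cong₂ _+_ (Σ∈-map (shiftFrom v) p _) refl) (counted x x≤n))
  where
  counted : ∀ x → x ≤ suc (suc n) → Σ∈ p (λ y → 𝟙 (shiftFrom v y <ᵇ x)) + (𝟙 (v <ᵇ x) + 0) ≡ x ∸ 1
  counted x x≤n with x ≤? v
  ... | yes x≤v =
    trans (cong₂ _+_ (trans (Σ∈-cong p (λ y → cong 𝟙 (shiftFrom-<ᵇ-below v x y x≤v)))
        (countBelow-grown g x (≤-trans x≤v v≤n)))
                     (cong (λ b → 𝟙 b + 0) (<ᵇ-false x≤v)))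
          (+-identityʳ _)
  counted zero _ | no 0≰v = ⊥-elim (0≰v z≤n)
  counted (suc x) (s≤s x≤n) | no x≰v =
    trans (cong₂ _+_ (trans (Σ∈-cong p (λ y → cong 𝟙 (shiftFrom-<ᵇ-above v x y v≤x))) (countBelow-grown g x x≤n))
                     (cong (λ b → 𝟙 b + 0) (<ᵇ-true (s≤s v≤x))))
          (trans (+-comm (x ∸ 1) 1) (m+[n∸m]≡n (≤-trans 1≤v v≤x)))
    where
    v≤x = ≤-pred (≰⇒> x≰v)

std-grown : ∀ {n q} → Grown n q → std q ≡ q
std-grown {n} {q} e = map-id-local (All.map
    (λ {x} (a , b) → trans (cong suc (trans (length-filterᵇ _ q) (countBelow-grown e x (≤-trans b (n≤1+n n)))))
    (m+[n∸m]≡n a)) (IsPerm.entries-bounded (Grown⇒IsPerm e)))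

restrict-grown : ∀ {n q} → Grown n q → restrict q n ≡ q
restrict-grown {n} {q} g = trans (cong std (take-all n q (≤-reflexive (IsPerm.size (Grown⇒IsPerm g))))) (std-grown g)

isLRmaxAt-extend : ∀ p v j → 1 ≤ v → j ≤ length p → isLRmaxAt (extend p v) j ≡ isLRmaxAt p j
isLRmaxAt-extend p v j 1≤v j≤|p| = all-range-cong 1 (j ∸ 1) (λ l p1 lj →
  let l≤ = ≤-trans lj (≤-trans (m∸n≤m j 1) j≤|p|) in
  trans (cong₂ _<ᵇ_ (at-extend p v l 1≤v l≤) (at-extend p v j 1≤v j≤|p|)) (shiftFrom-<ᵇ v (at p l) (at p j)))

isLRmaxAt-extend-last : ∀ {n p} → Grown n p → ∀ v → 1 ≤ v → v ≤ suc n → isLRmaxAt (extend p v) (suc n) ≡ (v ≡ᵇ suc n)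
isLRmaxAt-extend-last {n} {p} g v 1≤v v≤1+n with m≤n⇒m<n∨m≡n v≤1+n
... | inj₂ refl = trans (all-range 1 n (λ l p1 ln → trans
    (cong₂ _<ᵇ_ (at-extend p v l 1≤v (subst (l ≤_) (sym |p|≡n) ln))
    (subst (λ z → at (extend p v) (suc z) ≡ suc n) |p|≡n (at-extend-last p v)))
    (trans (cong (_<ᵇ suc n) (shiftFrom-< (s≤s (proj₂ (IsPerm.bounded perm l p1 ln)))))
    (<ᵇ-true (s≤s (proj₂ (IsPerm.bounded perm l p1 ln))))))) (sym (≡ᵇ-refl n))
  where
  perm = Grown⇒IsPerm g
  |p|≡n = IsPerm.size perm
... | inj₁ lt =
  let (l , l1 , ln , le) = IsPerm.onto perm v 1≤v (≤-pred lt) in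
  trans (all-range-false 1 n l l1 ln (trans
      (cong₂ _<ᵇ_ (trans (at-extend p v l 1≤v (subst (l ≤_) (sym |p|≡n) ln)) (cong (shiftFrom v) le))
      (subst (λ z → at (extend p v) (suc z) ≡ v) |p|≡n (at-extend-last p v)))
      (trans (cong (_<ᵇ v) (shiftFrom-≥ {v} {v} ≤-refl)) (<ᵇ-false (n≤1+n v))))) (sym (≡ᵇ-false (λ x → <-irrefl x lt)))
  where
  perm = Grown⇒IsPerm g
  |p|≡n = IsPerm.size perm

Dominated : List ℕ → ℕ → ℕ → Set
Dominated q m w = Σ ℕ λ a → Σ ℕ λ b → 1 ≤ a × a < b × b ≤ m × at q b < at q a × at q b ≡ w

range-pred< : ∀ {l j} → 1 ≤ j → l ≤ j ∸ 1 → l < j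
range-pred< {l} {j} j1 lj = ≤-trans (s≤s lj) (≤-reflexive (m+[n∸m]≡n j1))

<⇒≤∸1 : ∀ {l j} → l < j → l ≤ j ∸ 1
<⇒≤∸1 {l} {suc j} (s≤s p) = p

module _ {m q} (e : Grown m q) where
  private
    P = Grown⇒IsPerm e
    L = IsPerm.size P

  isLRmaxVal-true : ∀ w → 1 ≤ w → w ≤ m → ¬ Dominated q m w → isLRmaxVal q w ≡ true
  isLRmaxVal-true w p1 pm nn =
    let (j , j1 , jm , je) = IsPerm.onto P w p1 pm in
    any-range {λ j → (at q j ≡ᵇ w) ∧ isLRmaxAt q j} 1 (length q) j j1 (subst (j ≤_) (sym L) jm)
      (∧-true (subst (λ z → (z ≡ᵇ w) ≡ true) (sym je) (≡ᵇ-refl w))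
        (all-range {λ l → at q l <ᵇ at q j} 1 (j ∸ 1) (λ l l1 lj →
          let l<j = range-pred< j1 lj
          in earlier-smaller l j l1 l<j (≤-trans (<⇒≤ l<j) jm) j1 jm je)))
    where
    earlier-smaller : ∀ l j → 1 ≤ l → l < j → l ≤ m → 1 ≤ j → j ≤ m → at q j ≡ w → (at q l <ᵇ at q j) ≡ true
    earlier-smaller l j l1 lj lm j1 jm je with at q l <? at q j
    ... | yes lt = <ᵇ-true lt
    ... | no nlt = ⊥-elim (nn (l , j , l1 , lj , jm , ≤∧≢⇒< (≮⇒≥ nlt)
        (λ eq → <-irrefl (sym (IsPerm.injective P j l j1 jm l1 lm eq)) lj) , je))

  isLRmaxVal-false : ∀ w → Dominated q m w → isLRmaxVal q w ≡ false
  isLRmaxVal-false w (a , b , a1 , ab , bm , lt , be) =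
    any-range-false {λ j → (at q j ≡ᵇ w) ∧ isLRmaxAt q j} 1 (length q) (λ j j1 jl → not-at-LRmax j j1 (subst (j ≤_) L jl))
    where
    not-at-LRmax : ∀ j → 1 ≤ j → j ≤ m → ((at q j ≡ᵇ w) ∧ isLRmaxAt q j) ≡ false
    not-at-LRmax j j1 jm with at q j ≟ w
    ... | no ne = subst (λ z → (z ∧ isLRmaxAt q j) ≡ false) (sym (≡ᵇ-false ne)) refl
    ... | yes eq =
      let jb : j ≡ b
          jb = IsPerm.injective P j b j1 jm (≤-trans a1 (<⇒≤ ab)) bm (trans eq (sym be))
      in subst (λ z → (z ∧ isLRmaxAt q j) ≡ false) (sym (subst (λ z → (z ≡ᵇ w) ≡ true) (sym eq) (≡ᵇ-refl w)))
           (subst (λ j → isLRmaxAt q j ≡ false) (sym jb)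
               (all-range-false {λ l → at q l <ᵇ at q b} 1 (b ∸ 1) a a1 (<⇒≤∸1 ab) (<ᵇ-false (<⇒≤ lt))))

  isLRmaxVal-false⁻ : ∀ w → 1 ≤ w → w ≤ m → isLRmaxVal q w ≡ false → Dominated q m w
  isLRmaxVal-false⁻ w p1 pm ef =
    let (j , j1 , jm , je) = IsPerm.onto P w p1 pm
        lrf : isLRmaxAt q j ≡ false
        lrf = ≢true⇒≡false (λ et → true≢false (trans
            (sym (any-range {λ j → (at q j ≡ᵇ w) ∧ isLRmaxAt q j} 1 (length q) j j1 (subst (j ≤_) (sym L) jm)
            (∧-true (subst (λ z → (z ≡ᵇ w) ≡ true) (sym je) (≡ᵇ-refl w)) et))) ef))
        (l , l1 , lj , lf) = all-range-false⁻ {λ l → at q l <ᵇ at q j} 1 (j ∸ 1) lrf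
        l<j = range-pred< j1 lj
        lm = ≤-trans (<⇒≤ l<j) jm
    in l , j , l1 , l<j , jm , ≤∧≢⇒< (<ᵇ-false⁻ _ _ lf) (λ eq → <-irrefl (sym (IsPerm.injective P j l j1 jm l1 lm eq)) l<j) ,
        je

filterᵇ-accept : ∀ (P : ℕ → Bool) x xs → P x ≡ true → filterᵇ P (x ∷ xs) ≡ x ∷ filterᵇ P xs
filterᵇ-accept P x xs e rewrite e = refl
filterᵇ-reject : ∀ (P : ℕ → Bool) x xs → P x ≡ false → filterᵇ P (x ∷ xs) ≡ filterᵇ P xs
filterᵇ-reject P x xs e rewrite e = refl

maxSatisfying : (ℕ → Bool) → List ℕ → ℕ
maxSatisfying P xs = foldr _⊔_ 0 (filterᵇ P xs)

maxSatisfying-true : ∀ (P : ℕ → Bool) x xs → P x ≡ true → maxSatisfying P (x ∷ xs) ≡ x ⊔ maxSatisfying P xs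
maxSatisfying-true P x xs e = cong (foldr _⊔_ 0) (filterᵇ-accept P x xs e)
maxSatisfying-false : ∀ (P : ℕ → Bool) x xs → P x ≡ false → maxSatisfying P (x ∷ xs) ≡ maxSatisfying P xs
maxSatisfying-false P x xs e = cong (foldr _⊔_ 0) (filterᵇ-reject P x xs e)

maxSatisfying-upper : ∀ (P : ℕ → Bool) (h : ℕ → ℕ) k t → t < k → P (h t) ≡ true → h t ≤ maxSatisfying P (applyUpTo h k)
maxSatisfying-upper P h (suc k) zero _ e = subst (h 0 ≤_) (sym (maxSatisfying-true P (h 0) _ e)) (m≤m⊔n (h 0) _)
maxSatisfying-upper P h (suc k) (suc t) (s≤s lt) e = by-head (P (h 0)) refl
  where
  rest = applyUpTo (λ t → h (suc t)) k
  ih = maxSatisfying-upper P (λ t → h (suc t)) k t lt e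
  by-head : ∀ b → P (h 0) ≡ b → h (suc t) ≤ maxSatisfying P (applyUpTo h (suc k))
  by-head true P0 = subst (h (suc t) ≤_) (sym (maxSatisfying-true P (h 0) rest P0)) (≤-trans ih (m≤n⊔m (h 0) _))
  by-head false P0 = subst (h (suc t) ≤_) (sym (maxSatisfying-false P (h 0) rest P0)) ih

maxSatisfying-attained : ∀ (P : ℕ → Bool) (h : ℕ → ℕ) k → maxSatisfying P (applyUpTo h k) ≡ 0 ⊎ Σ ℕ
    (λ t → t < k × P (h t) ≡ true × h t ≡ maxSatisfying P (applyUpTo h k))
maxSatisfying-attained P h zero = inj₁ refl
maxSatisfying-attained P h (suc k) = by-head (P (h 0)) refl
  where
  rest = applyUpTo (λ t → h (suc t)) k
  ih = maxSatisfying-attained P (λ t → h (suc t)) k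
  by-head : ∀ b → P (h 0) ≡ b → maxSatisfying P (applyUpTo h (suc k)) ≡ 0 ⊎ Σ ℕ
      (λ t → t < suc k × P (h t) ≡ true × h t ≡ maxSatisfying P (applyUpTo h (suc k)))
  by-head true P0 with ⊔-sel (h 0) (maxSatisfying P rest)
  ... | inj₁ x = inj₂ (0 , z<s , P0 , sym (trans (maxSatisfying-true P (h 0) rest P0) x))
  ... | inj₂ x with ih
  ...   | inj₁ y = inj₁ (trans (maxSatisfying-true P (h 0) rest P0) (trans x y))
  ...   | inj₂ (t , lt , pe , he) = inj₂ (suc t , s<s lt , pe , trans he
      (sym (trans (maxSatisfying-true P (h 0) rest P0) x)))
  by-head false P0 with ih
  ... | inj₁ y = inj₁ (trans (maxSatisfying-false P (h 0) rest P0) y)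
  ... | inj₂ (t , lt , pe , he) = inj₂ (suc t , s<s lt , pe , trans he (sym (maxSatisfying-false P (h 0) rest P0)))

vsatOK-zero : ∀ q → vsatOK q 0 ≡ true
vsatOK-zero q = ∨-zeroʳ _

vsat≤length : ∀ q → vsat q ≤ length q
vsat≤length q with maxSatisfying-attained (vsatOK q) (λ t → t) (suc (length q))
... | inj₁ x = subst (_≤ length q) (sym x) z≤n
... | inj₂ (t , lt , pe , he) = subst (_≤ length q) he (≤-pred lt)

vsatOK-vsat : ∀ q → vsatOK q (vsat q) ≡ true
vsatOK-vsat q with maxSatisfying-attained (vsatOK q) (λ t → t) (suc (length q))
... | inj₁ x = subst (λ z → vsatOK q z ≡ true) (sym x) (vsatOK-zero q)
... | inj₂ (t , lt , pe , he) = subst (λ z → vsatOK q z ≡ true) he pe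

vsat-maximal : ∀ q r → r ≤ length q → vsatOK q r ≡ true → r ≤ vsat q
vsat-maximal q r rl e = maxSatisfying-upper (vsatOK q) (λ t → t) (suc (length q)) r (s≤s rl) e

vsatOK-suc : ∀ q r → vsatOK q (suc r) ≡ all (λ t → isLRmaxVal q (length q ∸ t)) (range 0 r)
vsatOK-suc q r = ∨-identityʳ _

∸-suc-bound : ∀ m w → m ∸ w ≤ suc (m ∸ suc w)
∸-suc-bound zero w = subst (_≤ suc (0 ∸ suc w)) (sym (0∸n≡0 w)) z≤n
∸-suc-bound (suc m) zero = ≤-refl
∸-suc-bound (suc m) (suc w) = ∸-suc-bound m w

∸-window : ∀ m s w → m ∸ suc s < w → m ∸ w ≤ s
∸-window zero s w _ = subst (_≤ s) (sym (0∸n≡0 w)) z≤n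
∸-window (suc m) s zero ()
∸-window (suc m) zero (suc w) (s≤s lt) = subst (_≤ 0) (sym (m≤n⇒m∸n≡0 lt)) z≤n
∸-window (suc m) (suc s) (suc w) lt = ≤-trans (∸-suc-bound m w) (s≤s (∸-window m s (suc w) lt))

vsat-top-LRmax : ∀ q w → length q ∸ vsat q < w → w ≤ length q → isLRmaxVal q w ≡ true
vsat-top-LRmax q w lt wl with vsat q | vsatOK-vsat q | vsat≤length q
... | zero | _ | _ = ⊥-elim (<⇒≱ lt wl)
... | suc s | ok | sl = subst (λ z → isLRmaxVal q z ≡ true) (m∸[m∸n]≡n wl)
    (all-range⁻ {λ t → isLRmaxVal q (length q ∸ t)} 0 s (trans (sym (vsatOK-suc q s)) ok) (length q ∸ w) z≤n
    (∸-window (length q) s w lt))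

vsat-next-notLRmax : ∀ q → vsat q < length q → isLRmaxVal q (length q ∸ vsat q) ≡ false
vsat-next-notLRmax q sl =
  let not-ok : vsatOK q (suc (vsat q)) ≡ false
      not-ok = ≢true⇒≡false (λ ok → <-irrefl refl (vsat-maximal q (suc (vsat q)) sl ok))
      (t , _ , t≤s , t-fails) = all-range-false⁻ {λ t → isLRmaxVal q (length q ∸ t)} 0 (vsat q)
                                                  (trans (sym (vsatOK-suc q (vsat q))) not-ok)
  in first-failure t t≤s t-fails
  where
  first-failure : ∀ t → t ≤ vsat q → isLRmaxVal q (length q ∸ t) ≡ false → isLRmaxVal q (length q ∸ vsat q) ≡ false
  first-failure t t≤s t-fails with m≤n⇒m<n∨m≡n t≤s
  ... | inj₂ refl = t-fails
  ... | inj₁ t<s = ⊥-elim (true≢false (trans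
      (sym (vsat-top-LRmax q (length q ∸ t) (∸-monoʳ-< t<s (vsat≤length q)) (m∸n≤m _ t))) t-fails))

vsatOK-from-LRmax : ∀ q s → s ≤ length q → (∀ w → length q ∸ s < w → w ≤ length q → isLRmaxVal q w ≡ true) →
                    vsatOK q s ≡ true
vsatOK-from-LRmax q zero _ _ = vsatOK-zero q
vsatOK-from-LRmax q (suc s) s≤n top-LRmax = trans (vsatOK-suc q s)
  (all-range {λ t → isLRmaxVal q (length q ∸ t)} 0 s
      (λ t _ t≤s → top-LRmax (length q ∸ t) (∸-monoʳ-< (s≤s t≤s) s≤n) (m∸n≤m _ t)))

vsat-unique : ∀ q s → s ≤ length q → (∀ w → length q ∸ s < w → w ≤ length q → isLRmaxVal q w ≡ true) →
              (s < length q → isLRmaxVal q (length q ∸ s) ≡ false) → vsat q ≡ s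
vsat-unique q s s≤n top-LRmax next-not =
  ≤-antisym (no-larger (vsat q) (vsat≤length q) (vsatOK-vsat q)) (vsat-maximal q s s≤n (vsatOK-from-LRmax q s s≤n top-LRmax))
  where
  no-larger : ∀ r → r ≤ length q → vsatOK q r ≡ true → r ≤ s
  no-larger r r≤n ok with r ≤? s
  ... | yes r≤s = r≤s
  no-larger (suc r′) r≤n ok | no r≰s = ⊥-elim (true≢false (trans (sym ok) (trans (vsatOK-suc q r′)
    (all-range-false {λ t → isLRmaxVal q (length q ∸ t)} 0 r′ s z≤n s≤r′ (next-not (≤-trans (s≤s s≤r′) r≤n))))))
    where
    s≤r′ = ≤-pred (≰⇒> r≰s)
  no-larger zero _ _ | no 0≰s = ⊥-elim (0≰s z≤n)

Has321 : List ℕ → Set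
Has321 q = Σ ℕ λ a → Σ ℕ λ b → Σ ℕ λ c → 1 ≤ a × a < b × b < c × c ≤ length q × at q b < at q a × at q c < at q b

avoids321≡false⇒Has321 : ∀ q → avoids321 q ≡ false → Has321 q
avoids321≡false⇒Has321 q e =
  let n = length q
      (a , a1 , an , ea) = any-range⁻ {λ a → any
          (λ b → any (λ c → (at q b <ᵇ at q a) ∧ (at q c <ᵇ at q b)) (range (suc b) n)) (range (suc a) n)} 1 n
          (not-injective e)
      (b , ab , bn , eb) = any-range⁻ {λ b → any (λ c → (at q b <ᵇ at q a) ∧ (at q c <ᵇ at q b)) (range (suc b) n)} (suc a) n
          ea
      (c , bc , cn , ec) = any-range⁻ {λ c → (at q b <ᵇ at q a) ∧ (at q c <ᵇ at q b)} (suc b) n eb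
  in a , b , c , a1 , ab , bc , cn , <ᵇ-true⁻ _ _ (∧-conicalˡ _ _ ec) , <ᵇ-true⁻ _ _ (∧-conicalʳ _ _ ec)

Has321⇒avoids321≡false : ∀ q → Has321 q → avoids321 q ≡ false
Has321⇒avoids321≡false q (a , b , c , a1 , ab , bc , cn , lba , lcb) =
  let n = length q in
  cong not (any-range {λ a → any (λ b → any (λ c → (at q b <ᵇ at q a) ∧ (at q c <ᵇ at q b)) (range (suc b) n))
      (range (suc a) n)} 1 n a a1 (≤-trans (<⇒≤ (<-trans ab bc)) cn)
   (any-range {λ b → any (λ c → (at q b <ᵇ at q a) ∧ (at q c <ᵇ at q b)) (range (suc b) n)} (suc a) n b ab
       (≤-trans (<⇒≤ bc) cn)
    (any-range {λ c → (at q b <ᵇ at q a) ∧ (at q c <ᵇ at q b)} (suc b) n c bc cn (∧-true (<ᵇ-true lba) (<ᵇ-true lcb)))))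

vsat-unique′ : ∀ q m s → length q ≡ m → s ≤
    m → (∀ w → m ∸ s < w → w ≤ m → isLRmaxVal q w ≡ true) → (s < m → isLRmaxVal q (m ∸ s) ≡ false) → vsat q ≡ s
vsat-unique′ q .(length q) s refl = vsat-unique q s

vsat-top-LRmax′ : ∀ q m → length q ≡ m → ∀ w → m ∸ vsat q < w → w ≤ m → isLRmaxVal q w ≡ true
vsat-top-LRmax′ q .(length q) refl = vsat-top-LRmax q

vsat-next-notLRmax′ : ∀ q m → length q ≡ m → vsat q < m → isLRmaxVal q (m ∸ vsat q) ≡ false
vsat-next-notLRmax′ q .(length q) refl = vsat-next-notLRmax q

vsat≤length′ : ∀ q m → length q ≡ m → vsat q ≤ m
vsat≤length′ q .(length q) refl = vsat≤length q

-- Appending v to a 321-avoider p of [n] with s = vsat p avoids 321 iff v > n ∸ s: the values of p that are not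
-- left-to-right maxima are exactly those dominated by an earlier entry, the largest of them is n ∸ s, and a
-- last entry below a dominated value completes a 321.
module Extension {n p} (g : Grown n p) (v : ℕ) (1≤v : 1 ≤ v) (v≤1+n : v ≤ suc n) where
  q = extend p v
  s = vsat p
  perm = Grown⇒IsPerm g
  |p|≡n : length p ≡ n
  |p|≡n = IsPerm.size perm
  grown : Grown (suc n) q
  grown = grow v g 1≤v v≤1+n
  |q|≡1+n : length q ≡ suc n
  |q|≡1+n = IsPerm.size (Grown⇒IsPerm grown)
  at-q : ∀ j → j ≤ n → at q j ≡ shiftFrom v (at p j)
  at-q j jn = at-extend p v j 1≤v (subst (j ≤_) (sym |p|≡n) jn)
  at-q-last : at q (suc n) ≡ v
  at-q-last = subst (λ l → at q (suc l) ≡ v) |p|≡n (at-extend-last p v)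
  s≤n : s ≤ n
  s≤n = vsat≤length′ p n |p|≡n

  top-dominated : s < n → Dominated p n (n ∸ s)
  top-dominated sn = isLRmaxVal-false⁻ g (n ∸ s) (m<n⇒0<n∸m sn) (m∸n≤m n s) (vsat-next-notLRmax′ p n |p|≡n sn)

  dominated≤ : ∀ w → Dominated p n w → w ≤ n ∸ s
  dominated≤ w nl with n ∸ s <? w
  ... | no x = ≮⇒≥ x
  ... | yes x = let (a , b , a1 , ab , bn , lt , be) = nl in ⊥-elim
                      (true≢false (trans (sym (vsat-top-LRmax′ p n |p|≡n w x
                      (subst (_≤ n) be (proj₂ (IsPerm.bounded perm b (≤-trans a1 (<⇒≤ ab)) bn)))))
                      (isLRmaxVal-false g w nl)))

  avoids-restrict : avoids321 q ≡ true → avoids321 p ≡ true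
  avoids-restrict q-avoids =
    ≢false⇒≡true λ p-has → true≢false (trans (sym q-avoids)
        (Has321⇒avoids321≡false q (lift (avoids321≡false⇒Has321 p p-has))))
    where
    lift : Has321 p → Has321 q
    lift (a , b , c , a1 , ab , bc , c≤|p| , lba , lcb) =
      a , b , c , a1 , ab , bc , ≤-trans c≤n (≤-trans (n≤1+n n) (≤-reflexive (sym |q|≡1+n))) ,
      subst₂ _<_ (sym (at-q b b≤n)) (sym (at-q a a≤n)) (shiftFrom-mono-< v _ _ lba) ,
      subst₂ _<_ (sym (at-q c c≤n)) (sym (at-q b b≤n)) (shiftFrom-mono-< v _ _ lcb)
      where
      c≤n = subst (c ≤_) |p|≡n c≤|p|
      b≤n = ≤-trans (<⇒≤ bc) c≤n
      a≤n = ≤-trans (<⇒≤ ab) b≤n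

  1+n≤|q| : suc n ≤ length q
  1+n≤|q| = ≤-reflexive (sym |q|≡1+n)

  avoids⇒above : avoids321 q ≡ true → (n ∸ s <ᵇ v) ≡ true
  avoids⇒above eq = ≢false⇒≡true λ ef →
    let v≤ : v ≤ n ∸ s
        v≤ = <ᵇ-false⁻ _ _ ef
        sn : s < n
        sn = m∸n≢0⇒n<m (λ z → <-irrefl refl (≤-trans 1≤v (subst (v ≤_) z v≤)))
        (a , b , a1 , ab , bn , lt , be) = top-dominated sn
        an = ≤-trans (<⇒≤ ab) bn
    in true≢false (trans (sym eq) (Has321⇒avoids321≡false q (a , b , suc n , a1 , ab , s≤s bn , 1+n≤|q| ,
         subst₂ _<_ (sym (at-q b bn)) (sym (at-q a an)) (shiftFrom-mono-< v _ _ lt) ,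
         subst₂ _<_ (sym at-q-last) (sym (at-q b bn)) (gap<shiftFrom v (at p b) (subst (v ≤_) (sym be) v≤)))))

  above⇒avoids : avoids321 p ≡ true → (n ∸ s <ᵇ v) ≡ true → avoids321 q ≡ true
  above⇒avoids ap vv = ≢false⇒≡true λ ef →
    let (a , b , c , a1 , ab , bc , cn , lba , lcb) = avoids321≡false⇒Has321 q ef
    in no-321 a b c a1 ab bc (subst (c ≤_) |q|≡1+n cn) lba lcb
    where
    no-321 : ∀ a b c → 1 ≤ a → a < b → b < c → c ≤ suc n → at q b < at q a → at q c < at q b → ⊥
    no-321 a b c a1 ab bc cn lba lcb with m≤n⇒m<n∨m≡n cn
    ... | inj₁ c<sn =
      let cn' = ≤-pred c<sn
          bn = ≤-trans (<⇒≤ bc) cn'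
          an = ≤-trans (<⇒≤ ab) bn
      in true≢false (trans (sym ap) (Has321⇒avoids321≡false p (a , b , c , a1 , ab , bc , subst (c ≤_) (sym |p|≡n) cn' ,
           shiftFrom-cancel-< v _ _ (subst₂ _<_ (at-q b bn) (at-q a an) lba) ,
           shiftFrom-cancel-< v _ _ (subst₂ _<_ (at-q c cn') (at-q b bn) lcb))))
    ... | inj₂ refl =
      let bn = ≤-pred bc
          an = ≤-trans (<⇒≤ ab) bn
          vb : v ≤ at p b
          vb = gap<shiftFrom⁻ v (at p b) (subst₂ _<_ at-q-last (at-q b bn) lcb)
          nl : Dominated p n (at p b)
          nl = a , b , a1 , ab , bn , shiftFrom-cancel-< v _ _ (subst₂ _<_ (at-q b bn) (at-q a an) lba) , refl
      in <⇒≱ (<ᵇ-true⁻ _ _ vv) (≤-trans vb (dominated≤ (at p b) nl))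

  avoids321-extend : avoids321 q ≡ (avoids321 p ∧ (n ∸ s <ᵇ v))
  avoids321-extend = ≡-by-truth (λ eq → ∧-true (avoids-restrict eq) (avoids⇒above eq))
      (λ eq → above⇒avoids (∧-conicalˡ _ _ eq) (∧-conicalʳ _ _ eq))

  dominated-in-extension : ∀ w → n ∸ s < v → Dominated q (suc n) w → w ≤ n ∸ s ⊎ (w ≡ v × v ≤ n)
  dominated-in-extension w vv (a , b , a1 , ab , bsn , lt , be) with m≤n⇒m<n∨m≡n bsn
  ... | inj₂ refl =
      let an = ≤-pred ab in
      inj₂ (trans (sym be) at-q-last , ≤-trans (gap<shiftFrom⁻ v (at p a) (subst₂ _<_ at-q-last (at-q a an) lt))
          (proj₂ (IsPerm.bounded perm a a1 an)))
  ... | inj₁ b<sn =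
      let bn = ≤-pred b<sn
          an = ≤-trans (<⇒≤ ab) bn
          nl : Dominated p n (at p b)
          nl = a , b , a1 , ab , bn , shiftFrom-cancel-< v _ _ (subst₂ _<_ (at-q b bn) (at-q a an) lt) , refl
          bd = dominated≤ (at p b) nl
      in inj₁ (subst (_≤ n ∸ s) (trans (sym (shiftFrom-< (≤-<-trans bd vv))) (trans (sym (at-q b bn)) be)) bd)

  vsat-extend : n ∸ s < v → vsat q ≡ (if v ≡ᵇ suc n then suc s else suc n ∸ v)
  vsat-extend vv with v ≟ suc n
  ... | yes refl rewrite ≡ᵇ-refl n = vsat-unique′ q (suc n) (suc s) |q|≡1+n (s≤s s≤n) top-LRmax next-not
    where
    top-LRmax : ∀ w → n ∸ s < w → w ≤ suc n → isLRmaxVal q w ≡ true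
    top-LRmax w lt wle = isLRmaxVal-true grown w (≤-trans (s≤s z≤n) lt) wle
        (λ nl → impossible (dominated-in-extension w vv nl))
      where
      impossible : w ≤ n ∸ s ⊎ (w ≡ suc n × suc n ≤ n) → ⊥
      impossible (inj₁ x) = <⇒≱ lt x
      impossible (inj₂ (_ , y)) = <-irrefl refl y
    next-not : suc s < suc n → isLRmaxVal q (n ∸ s) ≡ false
    next-not sn =
      let (a , b , a1 , ab , bn , lt , be) = top-dominated (≤-pred sn)
          an = ≤-trans (<⇒≤ ab) bn
      in isLRmaxVal-false grown (n ∸ s) (a , b , a1 , ab , ≤-trans bn (n≤1+n n) ,
           subst₂ _<_ (sym (at-q b bn)) (sym (at-q a an)) (shiftFrom-mono-< v _ _ lt) ,
           trans (at-q b bn) (trans (shiftFrom-< (subst (_< v) (sym be) vv)) be))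
  ... | no ne rewrite ≡ᵇ-false ne = vsat-unique′ q (suc n) (suc n ∸ v) |q|≡1+n (m∸n≤m _ v) top-LRmax next-not
    where
    v≤n : v ≤ n
    v≤n = ≤-pred (≤∧≢⇒< v≤1+n ne)
    n+1∸[n+1∸v]≡v : suc n ∸ (suc n ∸ v) ≡ v
    n+1∸[n+1∸v]≡v = m∸[m∸n]≡n v≤1+n
    top-LRmax : ∀ w → suc n ∸ (suc n ∸ v) < w → w ≤ suc n → isLRmaxVal q w ≡ true
    top-LRmax w lt' wle = isLRmaxVal-true grown w (≤-trans (s≤s z≤n) lt) wle
        (λ nl → impossible (dominated-in-extension w vv nl))
      where
      lt : v < w
      lt = subst (_< w) n+1∸[n+1∸v]≡v lt'
      impossible : w ≤ n ∸ s ⊎ (w ≡ v × v ≤ n) → ⊥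
      impossible (inj₁ x) = <⇒≱ (<-trans vv lt) x
      impossible (inj₂ (y , _)) = <-irrefl (sym y) lt
    next-not : suc n ∸ v < suc n → isLRmaxVal q (suc n ∸ (suc n ∸ v)) ≡ false
    next-not _ =
      let (a , a1 , an , ae) = IsPerm.onto perm v 1≤v v≤n in
      subst (λ z → isLRmaxVal q z ≡ false) (sym n+1∸[n+1∸v]≡v)
        (isLRmaxVal-false grown v (a , suc n , a1 , s≤s an , ≤-refl ,
          subst₂ _<_ (sym at-q-last) (sym (trans (at-q a an) (cong (shiftFrom v) ae)))
              (subst (v <_) (sym (shiftFrom-≥ {v} {v} ≤-refl)) ≤-refl) , at-q-last))

isIdList-extend : ∀ {n p} → Grown n p → ∀ v → 1 ≤ v → v ≤ suc n → isIdList (extend p v) (suc n) ≡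
    (isIdList p n ∧ (v ≡ᵇ suc n))
isIdList-extend {n} {p} g v 1≤v v≤1+n = trans
    (cong (_∧ all (λ i → at (extend p v) i ≡ᵇ i) (range 1 (suc n))) (trans (cong (_≡ᵇ suc n) |q|≡1+n) (≡ᵇ-refl n)))
    (trans (≡-by-truth restrict-identity extend-identity)
    (cong (λ z → (z ∧ all (λ i → at p i ≡ᵇ i) (range 1 n)) ∧ (v ≡ᵇ suc n)) (sym (trans (cong (_≡ᵇ n) |p|≡n) (≡ᵇ-refl n)))))
  where
  open Extension g v 1≤v v≤1+n
  restrict-identity : all (λ i → at q i ≡ᵇ i) (range 1 (suc n)) ≡ true → (true ∧ all (λ i → at p i ≡ᵇ i) (range 1 n)) ∧
      (v ≡ᵇ suc n) ≡ true
  restrict-identity h =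
    let hl = all-range⁻ {λ i → at q i ≡ᵇ i} 1 (suc n) h
        vt : v ≡ suc n
        vt = trans (sym at-q-last) (≡ᵇ-true⁻ _ _ (hl (suc n) (s≤s z≤n) ≤-refl))
    in ∧-true (all-range {λ i → at p i ≡ᵇ i} 1 n (λ i i1 iN →
         let x = at p i
             xn = proj₂ (IsPerm.bounded perm i i1 iN)
         in subst (λ z → (z ≡ᵇ i) ≡ true) (trans (at-q i iN) (shiftFrom-< (subst (x <_) (sym vt) (s≤s xn))))
             (hl i i1 (≤-trans iN (n≤1+n n))))) (subst (λ z → (z ≡ᵇ suc n) ≡ true) (sym vt) (≡ᵇ-refl n))
  extend-identity : (true ∧ all (λ i → at p i ≡ᵇ i) (range 1 n)) ∧ (v ≡ᵇ suc n) ≡ true → all (λ i → at q i ≡ᵇ i)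
      (range 1 (suc n)) ≡ true
  extend-identity h =
    let vt = ≡ᵇ-true⁻ _ _ (∧-conicalʳ _ _ h)
        hp = all-range⁻ {λ i → at p i ≡ᵇ i} 1 n (∧-conicalˡ _ _ h)
    in all-range {λ i → at q i ≡ᵇ i} 1 (suc n) (λ i i1 iN → entry-fixed i i1 iN vt hp)
    where
    entry-fixed : ∀ i → 1 ≤ i → i ≤ suc n → v ≡ suc n → (∀ t → 1 ≤ t → t ≤ n → (at p t ≡ᵇ t) ≡ true) → (at q i ≡ᵇ i) ≡ true
    entry-fixed i i1 iN vt hp with m≤n⇒m<n∨m≡n iN
    ... | inj₂ refl = subst (λ z → (z ≡ᵇ suc n) ≡ true) (sym (trans at-q-last vt)) (≡ᵇ-refl n)
    ... | inj₁ lt = let iN' = ≤-pred lt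
                        xe = ≡ᵇ-true⁻ _ _ (hp i i1 iN')
                    in subst (λ z → (z ≡ᵇ i) ≡ true) (sym (trans (at-q i iN')
                        (trans (cong (shiftFrom v) xe) (shiftFrom-< (subst (i <_) (sym vt) lt))))) (≡ᵇ-refl i)

top-extend : ∀ {m q} → Grown m q → ∀ v → 1 ≤ v → v ≤ suc m → ∀ j → 1 ≤ j → j ≤ m → (at (extend q v) j ≡ᵇ suc m) ≡
    ((at q j ≡ᵇ m) ∧ not (v ≡ᵇ suc m))
top-extend {m} {q} g v pv vle j j1 jm = trans
    (cong (_≡ᵇ suc m) (at-extend q v j pv (subst (j ≤_) (sym (IsPerm.size perm)) jm)))
    (top-shift (at q j) (proj₂ (IsPerm.bounded perm j j1 jm)))
  where
  perm = Grown⇒IsPerm g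
  top-shift : ∀ x → x ≤ m → (shiftFrom v x ≡ᵇ suc m) ≡ ((x ≡ᵇ m) ∧ not (v ≡ᵇ suc m))
  top-shift x xm with x <? v
  ... | yes lt rewrite shiftFrom-< lt = trans (≡ᵇ-false (λ z → <-irrefl z (s≤s xm))) (sym (not-top (x ≟ m)))
    where
    not-top : Dec (x ≡ m) → ((x ≡ᵇ m) ∧ not (v ≡ᵇ suc m)) ≡ false
    not-top (yes g) =
      let vv : v ≡ suc m
          vv = ≤-antisym vle (subst (λ z → suc z ≤ v) g lt)
      in trans (cong (_∧ not (v ≡ᵇ suc m)) (subst (λ z → (z ≡ᵇ m) ≡ true) (sym g) (≡ᵇ-refl m)))
          (cong not (subst (λ z → (z ≡ᵇ suc m) ≡ true) (sym vv) (≡ᵇ-refl m)))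
    not-top (no ne) rewrite ≡ᵇ-false ne = refl
  ... | no nlt rewrite shiftFrom-≥ (≮⇒≥ nlt) | ≡ᵇ-false {v} {suc m} (λ z → <-irrefl z (s≤s (≤-trans (≮⇒≥ nlt) xm))) = sym
      (∧-identityʳ _)

Σ<-window : ∀ m s (F : ℕ → ℕ) → s ≤ m → Σ< m (λ t → if (m ∸ s <ᵇ suc t) then F t else 0) ≡ Σ< s (λ c → F (m ∸ suc c))
Σ<-window m zero F _ = trans (Σ<-cong-local m (λ t lt → if-false (<ᵇ-false lt))) (Σ<-zero m)
Σ<-window (suc m) (suc s) F (s≤s sm) =
  trans (Σ<-suc m _) (trans (cong₂ _+_ (Σ<-window m s F sm) (if-true (<ᵇ-true (s≤s (m∸n≤m m s))))) (+-comm _ (F m)))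

Σ<-avoiding-extensions : ∀ {m p} → Grown m p → avoids321 p ≡ true → ∀ (χ : Bool → ℕ → ℕ) →
     Σ< (suc m) (λ t → if avoids321 (extend p (suc t)) then χ (suc t ≡ᵇ suc m) (vsat (extend p (suc t))) else 0)
     ≡ χ true (suc (vsat p)) + Σ< (vsat p) (λ c → χ false (suc c))
Σ<-avoiding-extensions {m} {p} g p-avoids χ =
  trans (Σ<-cong-local (suc m) (λ t lt → summand t (≤-pred lt)))
  (trans (Σ<-suc m _)
  (trans (cong₂ _+_ (Σ<-window m s after s≤m) (if-true (<ᵇ-true (s≤s (m∸n≤m m s)))))
  (trans (cong₂ _+_ (Σ<-cong-local s (λ c lt → after-below c lt)) (after-top))
      (+-comm (Σ< s (λ c → χ false (suc c))) (χ true (suc s))))))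
  where
  s = vsat p
  s≤m : s ≤ m
  s≤m = vsat≤length′ p m (IsPerm.size (Grown⇒IsPerm g))
  after : ℕ → ℕ
  after t = χ (suc t ≡ᵇ suc m) (if suc t ≡ᵇ suc m then suc s else suc m ∸ suc t)
  summand : ∀ t → t ≤ m → (if avoids321 (extend p (suc t)) then χ (suc t ≡ᵇ suc m) (vsat (extend p (suc t))) else 0) ≡
      (if (m ∸ s <ᵇ suc t) then after t else 0)
  summand t tm with m ∸ s <ᵇ suc t in ev
  ... | false = if-false (trans (Extension.avoids321-extend g (suc t) (s≤s z≤n) (s≤s tm))
      (trans (cong (_∧ (m ∸ s <ᵇ suc t)) p-avoids) ev))
  ... | true = trans (if-true (trans (Extension.avoids321-extend g (suc t) (s≤s z≤n) (s≤s tm))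
      (trans (cong (_∧ (m ∸ s <ᵇ suc t)) p-avoids) ev)))
      (cong (χ _) (Extension.vsat-extend g (suc t) (s≤s z≤n) (s≤s tm) (<ᵇ-true⁻ _ _ ev)))
  after-top : after m ≡ χ true (suc s)
  after-top rewrite ≡ᵇ-refl m = refl
  after-below : ∀ c → c < s → after (m ∸ suc c) ≡ χ false (suc c)
  after-below c cs =
    let sc≤m = ≤-trans cs s≤m
        ne : suc (m ∸ suc c) ≢ suc m
        ne z = <-irrefl (suc-injective z) (∸-monoʳ-< {m} {suc c} {0} (s≤s z≤n) sc≤m)
    in trans (cong₂ χ (≡ᵇ-false ne) (if-false (≡ᵇ-false ne))) (cong (χ false) (m∸[m∸n]≡n sc≤m))

-- The state of the threshold strategy: no candidate chosen yet, holding the current maximum, or overtaken.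
data Phase : Set where
  searching holding lost : Phase

isHolding : Phase → Bool
isHolding holding = true
isHolding searching = false
isHolding lost = false

advance : Phase → Bool → Bool → Phase
advance searching b m = if b ∧ m then holding else searching
advance holding b m = if b then lost else holding
advance lost b m = lost

advanceτ : ℕ → Phase → Bool → ℕ → Phase
advanceτ r st b l = advance st b (meetsτ r l)

-- The number of ways to append r more entries to a 321-avoider with l value-saturated left-to-right maxima
-- so that the strategy, now in phase st, ends up holding the maximum.
winsFrom : ℕ → Phase → ℕ → ℕ
winsFrom zero st l = 𝟙 (isHolding st)
winsFrom (suc r) st l = winsFrom r (advanceτ r st true (suc l)) (suc l) + Σ< l
    (λ c → winsFrom r (advanceτ r st false (suc c)) (suc c))

winsNested : ℕ → ℕ → List ℕ → Phase → ℕ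
winsNested zero m q st = 𝟙 (isHolding st)
winsNested (suc r) m q st = Σ< (suc m) (λ t → if avoids321 (extend q (suc t)) then winsNested r (suc m) (extend q (suc t))
    (advanceτ r st (suc t ≡ᵇ suc m) (vsat (extend q (suc t)))) else 0)

if-cong : ∀ b {X Y : ℕ} → (b ≡ true → X ≡ Y) → (if b then X else 0) ≡ (if b then Y else 0)
if-cong true f = f refl
if-cong false f = refl

winsNested≡winsFrom : ∀ r {m q} st → Grown m q → avoids321 q ≡ true → winsNested r m q st ≡ winsFrom r st (vsat q)
winsNested≡winsFrom zero st g q-avoids = refl
winsNested≡winsFrom (suc r) {m} {q} st g q-avoids =
  trans (Σ<-cong-local (suc m) (λ t lt → if-cong (avoids321 (extend q (suc t)))
      (λ extension-avoids → winsNested≡winsFrom r (advanceτ r st (suc t ≡ᵇ suc m) (vsat (extend q (suc t))))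
      (grow (suc t) g (s≤s z≤n) lt) extension-avoids)))
        (Σ<-avoiding-extensions g q-avoids (λ b l → winsFrom r (advanceτ r st b l) l))

Σ∈-grownPerms-cong : ∀ n {f g : List ℕ → ℕ} → (∀ p → Grown n p → f p ≡ g p) → Σ∈ (grownPerms n) f ≡ Σ∈ (grownPerms n) g
Σ∈-grownPerms-cong zero h = cong (_+ 0) (h [] root)
Σ∈-grownPerms-cong (suc n) {f} {g} h = trans (Σ∈-grownPerms-suc n f)
    (trans (Σ∈-grownPerms-cong n (λ p ep → Σ<-cong-local (suc n) (λ t lt → h _ (grow (suc t) ep (s≤s z≤n) lt))))
    (sym (Σ∈-grownPerms-suc n g)))

Φ : (ℕ → ℕ) → ℕ → ℕ
Φ χ a = Σ< (suc a) (λ t → χ (suc t))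

iterΦ : ℕ → (ℕ → ℕ) → ℕ → ℕ
iterΦ zero χ = χ
iterΦ (suc j) χ = iterΦ j (Φ χ)

Σ∈-identity-prefix : ∀ m (ψ : ℕ → ℕ) → Σ∈ (grownPerms m) (λ q → if avoids321 q ∧ isIdList q m then ψ (vsat q) else 0) ≡ ψ m
Σ∈-identity-prefix zero ψ = +-identityʳ (ψ 0)
Σ∈-identity-prefix (suc m) ψ = trans (Σ∈-grownPerms-suc m _)
    (trans (Σ∈-grownPerms-cong m extensions) (Σ∈-identity-prefix m (λ x → ψ (suc x))))
  where
  extensions : ∀ p → Grown m p → Σ< (suc m)
      (λ t → if avoids321 (extend p (suc t)) ∧ isIdList (extend p (suc t)) (suc m) then ψ (vsat (extend p (suc t))) else 0)
                     ≡ (if avoids321 p ∧ isIdList p m then ψ (suc (vsat p)) else 0)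
  extensions p g = by-cases (avoids321 p) refl (isIdList p m) refl
    where
    conditions : ∀ t → t < suc m → (avoids321 (extend p (suc t)) ∧ isIdList (extend p (suc t)) (suc m)) ≡
        ((avoids321 p ∧ (m ∸ vsat p <ᵇ suc t)) ∧ (isIdList p m ∧ (suc t ≡ᵇ suc m)))
    conditions t lt = cong₂ _∧_ (Extension.avoids321-extend g (suc t) (s≤s z≤n) lt) (isIdList-extend g (suc t) (s≤s z≤n) lt)
    by-cases : ∀ a → avoids321 p ≡ a → ∀ i → isIdList p m ≡ i → Σ< (suc m)
        (λ t → if avoids321 (extend p (suc t)) ∧ isIdList (extend p (suc t)) (suc m) then ψ (vsat (extend p (suc t))) else 0)
                     ≡ (if a ∧ i then ψ (suc (vsat p)) else 0)
    summand : ℕ → ℕ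
    summand t = if avoids321 (extend p (suc t)) ∧ isIdList (extend p (suc t)) (suc m) then ψ (vsat (extend p (suc t))) else 0
    by-cases false ea i ei = trans (Σ<-cong-local (suc m) {summand} {λ _ → 0}
        (λ t lt → if-false (trans (conditions t lt)
        (cong (λ z → (z ∧ (m ∸ vsat p <ᵇ suc t)) ∧ (isIdList p m ∧ (suc t ≡ᵇ suc m))) ea))))
        (Σ<-zero (suc m))
    by-cases true ea false ei = trans (Σ<-cong-local (suc m) {summand} {λ _ → 0}
        (λ t lt → if-false (trans (conditions t lt)
        (trans (cong (λ z → (avoids321 p ∧ (m ∸ vsat p <ᵇ suc t)) ∧ (z ∧ (suc t ≡ᵇ suc m))) ei)
        (∧-zeroʳ _))))) (Σ<-zero (suc m))
    by-cases true ea true ei = trans (Σ<-last m summand below-top) top-value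
      where
      below-top : ∀ t → t < m → summand t ≡ 0
      below-top t lt = if-false (trans (conditions t (≤-trans lt (n≤1+n m)))
          (trans (cong (λ z → (avoids321 p ∧ (m ∸ vsat p <ᵇ suc t)) ∧ (isIdList p m ∧ z))
          (≡ᵇ-false (λ z → <-irrefl (suc-injective z) lt)))
          (trans (cong ((avoids321 p ∧ (m ∸ vsat p <ᵇ suc t)) ∧_) (∧-zeroʳ (isIdList p m))) (∧-zeroʳ _))))
      top-counted : (avoids321 (extend p (suc m)) ∧ isIdList (extend p (suc m)) (suc m)) ≡ true
      top-counted = trans (conditions m ≤-refl)
          (trans (cong₂ (λ z w → (z ∧ (m ∸ vsat p <ᵇ suc m)) ∧ (w ∧ (suc m ≡ᵇ suc m))) ea ei)
          (cong₂ _∧_ (<ᵇ-true (s≤s (m∸n≤m m (vsat p)))) (≡ᵇ-refl m)))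
      top-value : summand m ≡ ψ (suc (vsat p))
      top-value = trans (if-true top-counted) (cong ψ
          (trans (Extension.vsat-extend g (suc m) (s≤s z≤n) ≤-refl (s≤s (m∸n≤m m (vsat p))))
          (cong (λ b → if b then suc (vsat p) else suc m ∸ suc m) (≡ᵇ-refl m))))

prefixId-extend : ∀ p v k → k ≤ length p → prefixId (extend p v) k ≡ prefixId p k
prefixId-extend p v k kl = cong (λ z → isIdList z k) (restrict-extend p v k kl)

Σ∈-prefixId : ∀ k j (χ : ℕ → ℕ) → Σ∈ (grownPerms (j + k)) (λ q → if avoids321 q ∧ prefixId q k then χ (vsat q) else 0) ≡
    iterΦ j χ k
Σ∈-prefixId k zero χ = trans (Σ∈-grownPerms-cong k
    (λ q eq → cong (λ b → if avoids321 q ∧ b then χ (vsat q) else 0) (cong (λ z → isIdList z k) (restrict-grown eq))))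
    (Σ∈-identity-prefix k χ)
Σ∈-prefixId k (suc j) χ = trans (Σ∈-grownPerms-suc (j + k) _)
    (trans (Σ∈-grownPerms-cong (j + k) extensions) (Σ∈-prefixId k j (Φ χ)))
  where
  m = j + k
  summand : List ℕ → ℕ
  summand q = if avoids321 q ∧ prefixId q k then χ (vsat q) else 0
  extensions : ∀ p → Grown m p → Σ< (suc m) (λ t → summand (extend p (suc t))) ≡
      (if avoids321 p ∧ prefixId p k then Φ χ (vsat p) else 0)
  extensions p g = by-cases (avoids321 p) refl (prefixId p k) refl
    where
    k≤|p| : k ≤ length p
    k≤|p| = subst (k ≤_) (sym (IsPerm.size (Grown⇒IsPerm g))) (m≤n+m k j)
    conditions : ∀ t → t < suc m → (avoids321 (extend p (suc t)) ∧ prefixId (extend p (suc t)) k) ≡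
        ((avoids321 p ∧ (m ∸ vsat p <ᵇ suc t)) ∧ prefixId p k)
    conditions t lt = cong₂ _∧_ (Extension.avoids321-extend g (suc t) (s≤s z≤n) lt) (prefixId-extend p (suc t) k k≤|p|)
    by-cases : ∀ a → avoids321 p ≡ a → ∀ i → prefixId p k ≡ i → Σ< (suc m) (λ t → summand (extend p (suc t))) ≡
        (if a ∧ i then Φ χ (vsat p) else 0)
    by-cases a ea false ei = trans (Σ<-cong-local (suc m) {λ t → summand (extend p (suc t))} {λ _ → 0}
        (λ t lt → if-false (trans (conditions t lt)
        (trans (cong ((avoids321 p ∧ (m ∸ vsat p <ᵇ suc t)) ∧_) ei) (∧-zeroʳ _)))))
        (trans (Σ<-zero (suc m)) (sym (if-false (∧-zeroʳ a))))
    by-cases false ea true ei = trans (Σ<-cong-local (suc m) {λ t → summand (extend p (suc t))} {λ _ → 0}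
        (λ t lt → if-false (trans (conditions t lt) (cong (λ z → (z ∧ (m ∸ vsat p <ᵇ suc t)) ∧ prefixId p k) ea))))
        (Σ<-zero (suc m))
    by-cases true ea true ei =
      trans (Σ<-cong-local (suc m) (λ t lt → cong (λ b → if b then χ (vsat (extend p (suc t))) else 0)
          (trans (conditions t lt) (trans (cong₂ (λ z w → (z ∧ (m ∸ vsat p <ᵇ suc t)) ∧ w) ea ei)
          (trans (∧-identityʳ _) (sym (trans (Extension.avoids321-extend g (suc t) (s≤s z≤n) lt)
          (cong (_∧ (m ∸ vsat p <ᵇ suc t)) ea))))))))
      (trans (Σ<-avoiding-extensions g ea (λ b l → χ l))
          (trans (+-comm (χ (suc (vsat p))) (Σ< (vsat p) (λ c → χ (suc c)))) (sym (Σ<-suc (vsat p) (λ t → χ (suc t))))))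

applyUpTo-++ : ∀ (h : ℕ → ℕ) a b → applyUpTo h (a + b) ≡ applyUpTo h a ++ applyUpTo (λ t → h (a + t)) b
applyUpTo-++ h zero b = refl
applyUpTo-++ h (suc a) b = cong (h 0 ∷_) (applyUpTo-++ (λ t → h (suc t)) a b)

applyUpTo-cong : ∀ (h h' : ℕ → ℕ) L → (∀ t → h t ≡ h' t) → applyUpTo h L ≡ applyUpTo h' L
applyUpTo-cong h h' zero e = refl
applyUpTo-cong h h' (suc L) e = cong₂ _∷_ (e 0) (applyUpTo-cong (λ t → h (suc t)) (λ t → h' (suc t)) L (λ t → e (suc t)))

findᵇ-skip : ∀ (P : ℕ → Bool) h L ys → (∀ t → t < L → P (h t) ≡ false) → findᵇ P (applyUpTo h L ++ ys) ≡ findᵇ P ys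
findᵇ-skip P h zero ys f = refl
findᵇ-skip P h (suc L) ys f = trans (if-false (f 0 z<s)) (findᵇ-skip P (λ t → h (suc t)) L ys (λ t lt → f (suc t) (s<s lt)))

range-last4 : ∀ k n → k ≤ n → range (suc k) (4 + n) ≡ range (suc k) n ++ (suc n ∷ 2 + n ∷ 3 + n ∷ 4 + n ∷ [])
range-last4 k n kn =
  trans (cong (applyUpTo (λ t → suc k + t)) (trans (cong (_∸ k) (+-comm 4 n)) (+-∸-comm 4 kn)))
  (trans (applyUpTo-++ (λ t → suc k + t) (n ∸ k) 4)
  (cong (range (suc k) n ++_) (applyUpTo-cong _ (λ t → t + suc n) 4 reindex)))
  where
  reindex : ∀ t → suc k + ((n ∸ k) + t) ≡ t + suc n
  reindex t = trans (cong suc (trans (sym (+-assoc k (n ∸ k) t)) (trans (cong (_+ t) (m+[n∸m]≡n kn)) (+-comm n t))))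
      (sym (+-suc t n))

winsAt : ℕ → List ℕ → Maybe ℕ → Bool
winsAt N π (just j) = at π j ≡ᵇ N
winsAt N π nothing = false

wins≡winsAt : ∀ N k π → wins N k π ≡ winsAt N π (stopPos N k π)
wins≡winsAt N k π with stopPos N k π
... | just j = refl
... | nothing = refl

holding-outcome₁ : ∀ T₄ M₄ → isHolding (advance holding T₄ M₄) ≡ not T₄
holding-outcome₁ true M₄ = refl
holding-outcome₁ false M₄ = refl

holding-outcome₂ : ∀ T₃ T₄ M₃ M₄ → isHolding (advance (advance holding T₃ M₃) T₄ M₄) ≡ not T₃ ∧ not T₄
holding-outcome₂ true T₄ M₃ M₄ = refl
holding-outcome₂ false T₄ M₃ M₄ = holding-outcome₁ T₄ M₄

holding-outcome₃ : ∀ T₂ T₃ T₄ M₂ M₃ M₄ →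
  isHolding (advance (advance (advance holding T₂ M₂) T₃ M₃) T₄ M₄) ≡ (not T₂ ∧ not T₃) ∧ not T₄
holding-outcome₃ true T₃ T₄ M₂ M₃ M₄ = refl
holding-outcome₃ false T₃ T₄ M₂ M₃ M₄ = holding-outcome₂ T₃ T₄ M₃ M₄

searching-outcome₁ : ∀ T₄ M₄ → (if T₄ ∧ M₄ then T₄ else false) ≡ isHolding (advance searching T₄ M₄)
searching-outcome₁ true true = refl
searching-outcome₁ true false = refl
searching-outcome₁ false M₄ = refl

searching-outcome₂ : ∀ T₃ T₄ M₃ M₄ →
  (if T₃ ∧ M₃ then T₃ ∧ not T₄ else (if T₄ ∧ M₄ then T₄ else false))
  ≡ isHolding (advance (advance searching T₃ M₃) T₄ M₄)
searching-outcome₂ true T₄ true M₄ = sym (holding-outcome₁ T₄ M₄)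
searching-outcome₂ true T₄ false M₄ = searching-outcome₁ T₄ M₄
searching-outcome₂ false T₄ M₃ M₄ = searching-outcome₁ T₄ M₄

searching-outcome₃ : ∀ T₂ T₃ T₄ M₂ M₃ M₄ →
  (if T₂ ∧ M₂ then (T₂ ∧ not T₃) ∧ not T₄ else (if T₃ ∧ M₃ then T₃ ∧ not T₄ else (if T₄ ∧ M₄ then T₄ else false)))
  ≡ isHolding (advance (advance (advance searching T₂ M₂) T₃ M₃) T₄ M₄)
searching-outcome₃ true T₃ T₄ true M₃ M₄ = sym (holding-outcome₂ T₃ T₄ M₃ M₄)
searching-outcome₃ true T₃ T₄ false M₃ M₄ = searching-outcome₂ T₃ T₄ M₃ M₄
searching-outcome₃ false T₃ T₄ M₂ M₃ M₄ = searching-outcome₂ T₃ T₄ M₃ M₄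

searching-outcome₄ : ∀ T₁ T₂ T₃ T₄ M₁ M₂ M₃ M₄ →
  (if T₁ ∧ M₁ then ((T₁ ∧ not T₂) ∧ not T₃) ∧ not T₄
   else (if T₂ ∧ M₂ then (T₂ ∧ not T₃) ∧ not T₄ else (if T₃ ∧ M₃ then T₃ ∧ not T₄ else (if T₄ ∧ M₄ then T₄ else false))))
  ≡ isHolding (advance (advance (advance (advance searching T₁ M₁) T₂ M₂) T₃ M₃) T₄ M₄)
searching-outcome₄ true T₂ T₃ T₄ true M₂ M₃ M₄ = sym (holding-outcome₃ T₂ T₃ T₄ M₂ M₃ M₄)
searching-outcome₄ true T₂ T₃ T₄ false M₂ M₃ M₄ = searching-outcome₃ T₂ T₃ T₄ M₂ M₃ M₄
searching-outcome₄ false T₂ T₃ T₄ M₁ M₂ M₃ M₄ = searching-outcome₃ T₂ T₃ T₄ M₂ M₃ M₄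

firstHit : Bool → Bool → Bool → Bool → Bool → Bool → Bool → Bool → Bool
firstHit c1 c2 c3 c4 avoids₁ avoids₂ avoids₃ A4 = if c1 then avoids₁ else
    (if c2 then avoids₂ else (if c3 then avoids₃ else (if c4 then A4 else false)))

firstHit-cong : ∀ c1 c2 c3 c4 {avoids₁ avoids₂ avoids₃ A4 A1' A2' A3' A4'} → avoids₁ ≡ A1' → avoids₂ ≡ A2' → avoids₃ ≡
    A3' → A4 ≡ A4' → firstHit c1 c2 c3 c4 avoids₁ avoids₂ avoids₃ A4 ≡ firstHit c1 c2 c3 c4 A1' A2' A3' A4'
firstHit-cong c1 c2 c3 c4 refl refl refl refl = refl

winsAt-firstHit : ∀ N π (j1 j2 j3 j4 : ℕ) c1 c2 c3 c4 → winsAt N π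
    (if c1 then just j1 else (if c2 then just j2 else (if c3 then just j3 else (if c4 then just j4 else nothing)))) ≡
    firstHit c1 c2 c3 c4 (at π j1 ≡ᵇ N) (at π j2 ≡ᵇ N) (at π j3 ≡ᵇ N) (at π j4 ≡ᵇ N)
winsAt-firstHit N π j1 j2 j3 j4 true c2 c3 c4 = refl
winsAt-firstHit N π j1 j2 j3 j4 false true c3 c4 = refl
winsAt-firstHit N π j1 j2 j3 j4 false false true c4 = refl
winsAt-firstHit N π j1 j2 j3 j4 false false false true = refl
winsAt-firstHit N π j1 j2 j3 j4 false false false false = refl

-- Since τ(i) = ∞ for i ≥ 4, the strategy can only stop at one of the last four positions.
module LastFour (n k : ℕ) (k<n : k < n) {p : List ℕ} (g : Grown n p) (v₁ v₂ v₃ v₄ : ℕ)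
         (1≤v₁ : 1 ≤ v₁) (v₁≤ : v₁ ≤ suc n) (1≤v₂ : 1 ≤ v₂) (v₂≤ : v₂ ≤ 2 + n)
         (1≤v₃ : 1 ≤ v₃) (v₃≤ : v₃ ≤ 3 + n) (1≤v₄ : 1 ≤ v₄) (v₄≤ : v₄ ≤ 4 + n) where
  π₁ = extend p v₁
  g₁ : Grown (suc n) π₁
  g₁ = grow v₁ g 1≤v₁ v₁≤
  π₂ = extend π₁ v₂
  g₂ : Grown (2 + n) π₂
  g₂ = grow v₂ g₁ 1≤v₂ v₂≤
  π₃ = extend π₂ v₃
  g₃ : Grown (3 + n) π₃
  g₃ = grow v₃ g₂ 1≤v₃ v₃≤
  π = extend π₃ v₄
  g₄ : Grown (4 + n) π
  g₄ = grow v₄ g₃ 1≤v₄ v₄≤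
  |p| : length p ≡ n
  |p| = IsPerm.size (Grown⇒IsPerm g)
  |π₁| : length π₁ ≡ suc n
  |π₁| = IsPerm.size (Grown⇒IsPerm g₁)
  |π₂| : length π₂ ≡ 2 + n
  |π₂| = IsPerm.size (Grown⇒IsPerm g₂)
  |π₃| : length π₃ ≡ 3 + n
  |π₃| = IsPerm.size (Grown⇒IsPerm g₃)
  T₁ = v₁ ≡ᵇ suc n
  T₂ = v₂ ≡ᵇ 2 + n
  T₃ = v₃ ≡ᵇ 3 + n
  T₄ = v₄ ≡ᵇ 4 + n
  M₁ = meetsτ 3 (vsat π₁)
  M₂ = meetsτ 2 (vsat π₂)
  M₃ = meetsτ 1 (vsat π₃)
  M₄ = meetsτ 0 (vsat π)
  phase : Phase
  phase = advanceτ 0 (advanceτ 1 (advanceτ 2 (advanceτ 3 searching T₁ (vsat π₁)) T₂ (vsat π₂)) T₃ (vsat π₃)) T₄ (vsat π)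

  ≤-length : ∀ {a b} → a ≤ b → ∀ {l} → l ≡ b → a ≤ l
  ≤-length p q = subst (_ ≤_) (sym q) p

  stopsAt : ℕ → Bool
  stopsAt j = isLRmaxAt π j ∧ meetsτ ((4 + n) ∸ j) (vsat (restrict π j))

  lrmax₁ : isLRmaxAt π (suc n) ≡ T₁
  lrmax₁ = trans (isLRmaxAt-extend π₃ v₄ (suc n) 1≤v₄ (≤-length (s≤s (m≤n+m n 2)) |π₃|))
      (trans (isLRmaxAt-extend π₂ v₃ (suc n) 1≤v₃ (≤-length (s≤s (m≤n+m n 1)) |π₂|))
      (trans (isLRmaxAt-extend π₁ v₂ (suc n) 1≤v₂ (≤-length ≤-refl |π₁|)) (isLRmaxAt-extend-last g v₁ 1≤v₁ v₁≤)))
  lrmax₂ : isLRmaxAt π (2 + n) ≡ T₂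
  lrmax₂ = trans (isLRmaxAt-extend π₃ v₄ (2 + n) 1≤v₄ (≤-length (s≤s (s≤s (m≤n+m n 1))) |π₃|))
      (trans (isLRmaxAt-extend π₂ v₃ (2 + n) 1≤v₃ (≤-length ≤-refl |π₂|)) (isLRmaxAt-extend-last g₁ v₂ 1≤v₂ v₂≤))
  lrmax₃ : isLRmaxAt π (3 + n) ≡ T₃
  lrmax₃ = trans (isLRmaxAt-extend π₃ v₄ (3 + n) 1≤v₄ (≤-length ≤-refl |π₃|)) (isLRmaxAt-extend-last g₂ v₃ 1≤v₃ v₃≤)
  lrmax₄ : isLRmaxAt π (4 + n) ≡ T₄
  lrmax₄ = isLRmaxAt-extend-last g₃ v₄ 1≤v₄ v₄≤

  restrict₁ : restrict π (suc n) ≡ π₁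
  restrict₁ = trans (restrict-extend π₃ v₄ (suc n) (≤-length (s≤s (m≤n+m n 2)) |π₃|))
      (trans (restrict-extend π₂ v₃ (suc n) (≤-length (s≤s (m≤n+m n 1)) |π₂|))
      (trans (restrict-extend π₁ v₂ (suc n) (≤-length ≤-refl |π₁|)) (restrict-grown g₁)))
  restrict₂ : restrict π (2 + n) ≡ π₂
  restrict₂ = trans (restrict-extend π₃ v₄ (2 + n) (≤-length (s≤s (s≤s (m≤n+m n 1))) |π₃|))
      (trans (restrict-extend π₂ v₃ (2 + n) (≤-length ≤-refl |π₂|)) (restrict-grown g₂))
  restrict₃ : restrict π (3 + n) ≡ π₃
  restrict₃ = trans (restrict-extend π₃ v₄ (3 + n) (≤-length ≤-refl |π₃|)) (restrict-grown g₃)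
  restrict₄ : restrict π (4 + n) ≡ π
  restrict₄ = restrict-grown g₄

  stopsAt₁ : stopsAt (suc n) ≡ (T₁ ∧ M₁)
  stopsAt₁ = cong₂ _∧_ lrmax₁ (cong₂ meetsτ (m+n∸n≡m 3 n) (cong vsat restrict₁))
  stopsAt₂ : stopsAt (2 + n) ≡ (T₂ ∧ M₂)
  stopsAt₂ = cong₂ _∧_ lrmax₂ (cong₂ meetsτ (m+n∸n≡m 2 n) (cong vsat restrict₂))
  stopsAt₃ : stopsAt (3 + n) ≡ (T₃ ∧ M₃)
  stopsAt₃ = cong₂ _∧_ lrmax₃ (cong₂ meetsτ (m+n∸n≡m 1 n) (cong vsat restrict₃))
  stopsAt₄ : stopsAt (4 + n) ≡ (T₄ ∧ M₄)
  stopsAt₄ = cong₂ _∧_ lrmax₄ (cong₂ meetsτ (n∸n≡0 n) (cong vsat restrict₄))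

  last₁ : at π₁ (suc n) ≡ v₁
  last₁ = subst (λ l → at π₁ (suc l) ≡ v₁) |p| (at-extend-last p v₁)
  last₂ : at π₂ (2 + n) ≡ v₂
  last₂ = subst (λ l → at π₂ (suc l) ≡ v₂) |π₁| (at-extend-last π₁ v₂)
  last₃ : at π₃ (3 + n) ≡ v₃
  last₃ = subst (λ l → at π₃ (suc l) ≡ v₃) |π₂| (at-extend-last π₂ v₃)
  last₄ : at π (4 + n) ≡ v₄
  last₄ = subst (λ l → at π (suc l) ≡ v₄) |π₃| (at-extend-last π₃ v₄)

  top₁ : (at π (suc n) ≡ᵇ 4 + n) ≡ (((T₁ ∧ not T₂) ∧ not T₃) ∧ not T₄)
  top₁ = trans (top-extend g₃ v₄ 1≤v₄ v₄≤ (suc n) (s≤s z≤n) (s≤s (m≤n+m n 2)))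
        (cong (_∧ not T₄) (trans (top-extend g₂ v₃ 1≤v₃ v₃≤ (suc n) (s≤s z≤n) (s≤s (m≤n+m n 1)))
        (cong (_∧ not T₃) (trans (top-extend g₁ v₂ 1≤v₂ v₂≤ (suc n) (s≤s z≤n) ≤-refl)
            (cong (λ z → (z ≡ᵇ suc n) ∧ not T₂) last₁)))))
  top₂ : (at π (2 + n) ≡ᵇ 4 + n) ≡ ((T₂ ∧ not T₃) ∧ not T₄)
  top₂ = trans (top-extend g₃ v₄ 1≤v₄ v₄≤ (2 + n) (s≤s z≤n) (s≤s (s≤s (m≤n+m n 1))))
        (cong (_∧ not T₄) (trans (top-extend g₂ v₃ 1≤v₃ v₃≤ (2 + n) (s≤s z≤n) ≤-refl)
            (cong (λ z → (z ≡ᵇ 2 + n) ∧ not T₃) last₂)))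
  top₃ : (at π (3 + n) ≡ᵇ 4 + n) ≡ (T₃ ∧ not T₄)
  top₃ = trans (top-extend g₃ v₄ 1≤v₄ v₄≤ (3 + n) (s≤s z≤n) ≤-refl) (cong (λ z → (z ≡ᵇ 3 + n) ∧ not T₄) last₃)
  top₄ : (at π (4 + n) ≡ᵇ 4 + n) ≡ T₄
  top₄ = cong (_≡ᵇ 4 + n) last₄

  no-stop-before : ∀ t → t < n ∸ k → stopsAt (suc k + t) ≡ false
  no-stop-before t lt = trans (cong (λ z → isLRmaxAt π (suc k + t) ∧ meetsτ z (vsat (restrict π (suc k + t))))
      (+-∸-assoc 4 (range-bound (suc k) n t lt))) (∧-zeroʳ _)

  stopPos≡ : stopPos (4 + n) k π ≡ (if T₁ ∧ M₁ then just (suc n) else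
      (if T₂ ∧ M₂ then just (2 + n) else (if T₃ ∧ M₃ then just (3 + n) else (if T₄ ∧ M₄ then just (4 + n) else nothing))))
  stopPos≡ = trans (cong (findᵇ stopsAt) (range-last4 k n (<⇒≤ k<n)))
       (trans (findᵇ-skip stopsAt (λ t → suc k + t) (n ∸ k) _ no-stop-before)
       (cong₂ (λ x y → if x then just (suc n) else y) stopsAt₁
           (cong₂ (λ x y → if x then just (2 + n) else y) stopsAt₂
           (cong₂ (λ x y → if x then just (3 + n) else y) stopsAt₃
           (cong (λ x → if x then just (4 + n) else nothing) stopsAt₄)))))

  wins≡phase : wins (4 + n) k π ≡ isHolding phase
  wins≡phase = trans (wins≡winsAt (4 + n) k π)
      (trans (cong (winsAt (4 + n) π) stopPos≡)
      (trans (winsAt-firstHit (4 + n) π (suc n) (2 + n) (3 + n) (4 + n) (T₁ ∧ M₁) (T₂ ∧ M₂) (T₃ ∧ M₃) (T₄ ∧ M₄))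
         (trans (firstHit-cong (T₁ ∧ M₁) (T₂ ∧ M₂) (T₃ ∧ M₃) (T₄ ∧ M₄) top₁ top₂ top₃ top₄)
             (searching-outcome₄ T₁ T₂ T₃ T₄ M₁ M₂ M₃ M₄))))

guarded : List Bool → ℕ → ℕ
guarded [] x = x
guarded (b ∷ bs) x = if b then guarded bs x else 0

guarded-zero : ∀ bs → guarded bs 0 ≡ 0
guarded-zero [] = refl
guarded-zero (true ∷ bs) = guarded-zero bs
guarded-zero (false ∷ bs) = refl

Σ<-guarded : ∀ L bs (f : ℕ → ℕ) → Σ< L (λ t → guarded bs (f t)) ≡ guarded bs (Σ< L f)
Σ<-guarded L [] f = refl
Σ<-guarded L (true ∷ bs) f = Σ<-guarded L bs f
Σ<-guarded L (false ∷ bs) f = Σ<-zero L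

counted : ℕ → ℕ → List ℕ → Bool
counted N k π = avoids321 π ∧ prefixId π k ∧ wins N k π

module LastFourSum (n k : ℕ) (k<n : k < n) {p : List ℕ} (g : Grown n p) where
  prefix-ok = prefixId p k
  q1 : ℕ → List ℕ
  q1 t1 = extend p (suc t1)
  q2 : ℕ → ℕ → List ℕ
  q2 t1 t2 = extend (q1 t1) (suc t2)
  q3 : ℕ → ℕ → ℕ → List ℕ
  q3 t1 t2 t3 = extend (q2 t1 t2) (suc t3)
  q4 : ℕ → ℕ → ℕ → ℕ → List ℕ
  q4 t1 t2 t3 t4 = extend (q3 t1 t2 t3) (suc t4)
  phase₁ : ℕ → Phase
  phase₁ t1 = advanceτ 3 searching (suc t1 ≡ᵇ suc n) (vsat (q1 t1))
  phase₂ : ℕ → ℕ → Phase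
  phase₂ t1 t2 = advanceτ 2 (phase₁ t1) (suc t2 ≡ᵇ 2 + n) (vsat (q2 t1 t2))
  phase₃ : ℕ → ℕ → ℕ → Phase
  phase₃ t1 t2 t3 = advanceτ 1 (phase₂ t1 t2) (suc t3 ≡ᵇ 3 + n) (vsat (q3 t1 t2 t3))
  phase₄ : ℕ → ℕ → ℕ → ℕ → Phase
  phase₄ t1 t2 t3 t4 = advanceτ 0 (phase₃ t1 t2 t3) (suc t4 ≡ᵇ 4 + n) (vsat (q4 t1 t2 t3 t4))

  indicator≡guarded : ∀ t1 t2 t3 t4 → t1 < suc n → t2 < 2 + n → t3 < 3 + n → t4 < 4 + n →
       𝟙 (counted (4 + n) k (q4 t1 t2 t3 t4)) ≡ guarded
           (prefix-ok ∷ avoids321 (q1 t1) ∷ avoids321 (q2 t1 t2) ∷ avoids321 (q3 t1 t2 t3) ∷ avoids321 (q4 t1 t2 t3 t4) ∷ [])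
           (𝟙 (isHolding (phase₄ t1 t2 t3 t4)))
  indicator≡guarded t1 t2 t3 t4 v₁≤ v₂≤ v₃≤ v₄≤ = by-avoidance (avoids321 (q4 t1 t2 t3 t4)) refl
    where
    open LastFour n k k<n g (suc t1) (suc t2) (suc t3) (suc t4) (s≤s z≤n) v₁≤ (s≤s z≤n) v₂≤ (s≤s z≤n) v₃≤ (s≤s z≤n) v₄≤
    bs = prefix-ok ∷ avoids321 (q1 t1) ∷ avoids321 (q2 t1 t2) ∷ avoids321 (q3 t1 t2 t3) ∷ []
    by-avoidance : ∀ b → avoids321 (q4 t1 t2 t3 t4) ≡ b → 𝟙 (counted (4 + n) k (q4 t1 t2 t3 t4)) ≡ guarded bs
        (if b then 𝟙 (isHolding (phase₄ t1 t2 t3 t4)) else 0)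
    by-avoidance false q-avoids = trans (cong (λ z → 𝟙 (z ∧ prefixId π k ∧ wins (4 + n) k π)) q-avoids)
        (sym (guarded-zero bs))
    by-avoidance true q-avoids =
      let avoids₃′ = Extension.avoids-restrict g₃ (suc t4) (s≤s z≤n) v₄≤ q-avoids
          avoids₂′ = Extension.avoids-restrict g₂ (suc t3) (s≤s z≤n) v₃≤ avoids₃′
          avoids₁′ = Extension.avoids-restrict g₁ (suc t2) (s≤s z≤n) v₂≤ avoids₂′
          prefix≡ : prefixId π k ≡ prefix-ok
          prefix≡ = trans (prefixId-extend π₃ (suc t4) k (≤-length (≤-trans (<⇒≤ k<n) (m≤n+m n 3)) |π₃|))
              (trans (prefixId-extend π₂ (suc t3) k (≤-length (≤-trans (<⇒≤ k<n) (m≤n+m n 2)) |π₂|))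
              (trans (prefixId-extend π₁ (suc t2) k (≤-length (≤-trans (<⇒≤ k<n) (m≤n+m n 1)) |π₁|))
              (prefixId-extend p (suc t1) k (≤-length (<⇒≤ k<n) |p|))))
      in trans (cong₂ (λ x y → 𝟙 (x ∧ y ∧ wins (4 + n) k π)) q-avoids prefix≡)
          (trans (cong (λ w → 𝟙 (prefix-ok ∧ w)) wins≡phase)
          (trans (reassociate prefix-ok) (cong (λ l → guarded (prefix-ok ∷ l) (𝟙 (isHolding phase)))
              (cong₂ _∷_ (sym avoids₁′) (cong₂ _∷_ (sym avoids₂′) (cong (_∷ []) (sym avoids₃′)))))))
      where
      reassociate : ∀ b → 𝟙 (true ∧ b ∧ isHolding phase) ≡ guarded (b ∷ true ∷ true ∷ true ∷ []) (𝟙 (isHolding phase))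
      reassociate true = refl
      reassociate false = refl

  avoids₁ : ℕ → Bool
  avoids₁ t1 = avoids321 (q1 t1)
  avoids₂ : ℕ → ℕ → Bool
  avoids₂ t1 t2 = avoids321 (q2 t1 t2)
  avoids₃ : ℕ → ℕ → ℕ → Bool
  avoids₃ t1 t2 t3 = avoids321 (q3 t1 t2 t3)

  Σ-level₄ : ∀ t1 t2 t3 → t1 < suc n → t2 < 2 + n → t3 < 3 + n →
        Σ< (4 + n) (λ t4 → 𝟙 (counted (4 + n) k (q4 t1 t2 t3 t4))) ≡ guarded
            (prefix-ok ∷ avoids₁ t1 ∷ avoids₂ t1 t2 ∷ avoids₃ t1 t2 t3 ∷ [])
            (winsNested 1 (3 + n) (q3 t1 t2 t3) (phase₃ t1 t2 t3))
  Σ-level₄ t1 t2 t3 v₁≤ v₂≤ v₃≤ = trans (Σ<-cong-local (4 + n) (λ t4 v₄≤ → indicator≡guarded t1 t2 t3 t4 v₁≤ v₂≤ v₃≤ v₄≤))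
      (Σ<-guarded (4 + n) (prefix-ok ∷ avoids₁ t1 ∷ avoids₂ t1 t2 ∷ avoids₃ t1 t2 t3 ∷ [])
      (λ t4 → if avoids321 (q4 t1 t2 t3 t4) then 𝟙 (isHolding (phase₄ t1 t2 t3 t4)) else 0))

  Σ-level₃ : ∀ t1 t2 → t1 < suc n → t2 < 2 + n →
        Σ< (3 + n) (λ t3 → Σ< (4 + n) (λ t4 → 𝟙 (counted (4 + n) k (q4 t1 t2 t3 t4)))) ≡ guarded
            (prefix-ok ∷ avoids₁ t1 ∷ avoids₂ t1 t2 ∷ []) (winsNested 2 (2 + n) (q2 t1 t2) (phase₂ t1 t2))
  Σ-level₃ t1 t2 v₁≤ v₂≤ = trans (Σ<-cong-local (3 + n) (λ t3 v₃≤ → Σ-level₄ t1 t2 t3 v₁≤ v₂≤ v₃≤))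
      (Σ<-guarded (3 + n) (prefix-ok ∷ avoids₁ t1 ∷ avoids₂ t1 t2 ∷ [])
      (λ t3 → if avoids₃ t1 t2 t3 then winsNested 1 (3 + n) (q3 t1 t2 t3) (phase₃ t1 t2 t3) else 0))

  Σ-level₂ : ∀ t1 → t1 < suc n →
        Σ< (2 + n) (λ t2 → Σ< (3 + n) (λ t3 → Σ< (4 + n) (λ t4 → 𝟙 (counted (4 + n) k (q4 t1 t2 t3 t4))))) ≡ guarded
            (prefix-ok ∷ avoids₁ t1 ∷ []) (winsNested 3 (suc n) (q1 t1) (phase₁ t1))
  Σ-level₂ t1 v₁≤ = trans (Σ<-cong-local (2 + n) (λ t2 v₂≤ → Σ-level₃ t1 t2 v₁≤ v₂≤))
      (Σ<-guarded (2 + n) (prefix-ok ∷ avoids₁ t1 ∷ [])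
      (λ t2 → if avoids₂ t1 t2 then winsNested 2 (2 + n) (q2 t1 t2) (phase₂ t1 t2) else 0))

  Σ-level₁ : Σ< (suc n) (λ t1 → Σ< (2 + n) (λ t2 → Σ< (3 + n)
      (λ t3 → Σ< (4 + n) (λ t4 → 𝟙 (counted (4 + n) k (q4 t1 t2 t3 t4)))))) ≡ guarded (prefix-ok ∷ [])
      (winsNested 4 n p searching)
  Σ-level₁ = trans (Σ<-cong-local (suc n) (λ t1 v₁≤ → Σ-level₂ t1 v₁≤))
      (Σ<-guarded (suc n) (prefix-ok ∷ []) (λ t1 → if avoids₁ t1 then winsNested 3 (suc n) (q1 t1) (phase₁ t1) else 0))

  Σ-last-four : Σ< (suc n) (λ t1 → Σ< (2 + n)
      (λ t2 → Σ< (3 + n) (λ t3 → Σ< (4 + n) (λ t4 → 𝟙 (counted (4 + n) k (q4 t1 t2 t3 t4)))))) ≡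
      (if avoids321 p ∧ prefix-ok then winsFrom 4 searching (vsat p) else 0)
  Σ-last-four = trans Σ-level₁ (by-avoidance (avoids321 p) refl)
    where
    by-avoidance : ∀ a → avoids321 p ≡ a → guarded (prefix-ok ∷ []) (winsNested 4 n p searching) ≡
        (if a ∧ prefix-ok then winsFrom 4 searching (vsat p) else 0)
    by-avoidance true p-avoids = cong (λ z → if prefix-ok then z else 0) (winsNested≡winsFrom 4 searching g p-avoids)
    by-avoidance false p-avoids = trans (cong (λ z → if prefix-ok then z else 0)
        (trans (Σ<-cong-local (suc n) {λ t1 → if avoids₁ t1 then winsNested 3 (suc n) (q1 t1) (phase₁ t1) else 0} {λ _ → 0}
        (λ t1 v₁≤ → if-false (trans (Extension.avoids321-extend g (suc t1) (s≤s z≤n) v₁≤)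
        (cong (_∧ (n ∸ vsat p <ᵇ suc t1)) p-avoids)))) (Σ<-zero (suc n)))) (if-eta prefix-ok)

Σ∈-grownPerms-4 : ∀ n (f : List ℕ → ℕ) → Σ∈ (grownPerms (4 + n)) f ≡ Σ∈ (grownPerms n)
    (λ p → Σ< (suc n) (λ t1 → Σ< (2 + n)
    (λ t2 → Σ< (3 + n) (λ t3 → Σ< (4 + n)
    (λ t4 → f (extend (extend (extend (extend p (suc t1)) (suc t2)) (suc t3)) (suc t4)))))))
Σ∈-grownPerms-4 n f = trans (Σ∈-grownPerms-suc (3 + n) f)
    (trans (Σ∈-grownPerms-suc (2 + n) _) (trans (Σ∈-grownPerms-suc (1 + n) _) (Σ∈-grownPerms-suc n _)))

Bc149≡iterΦ : ∀ j k → Bc149 (4 + (suc j + k)) k ≡ iterΦ (suc j) (winsFrom 4 searching) k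
Bc149≡iterΦ j k =
  trans (length-filterᵇ (counted N k) (perms N))
  (trans (Σ∈-perms≡Σ∈-grownPerms N (λ π → 𝟙 (counted N k π)))
  (trans (Σ∈-grownPerms-4 n (λ π → 𝟙 (counted N k π)))
  (trans (Σ∈-grownPerms-cong n (λ p g → LastFourSum.Σ-last-four n k k<n g))
  (Σ∈-prefixId k (suc j) (winsFrom 4 searching)))))
  where
  n = suc j + k
  N = 4 + n
  k<n : k < n
  k<n = s≤s (m≤n+m k j)

iterΦ-suc : ∀ i (χ : ℕ → ℕ) a → iterΦ (suc i) χ a ≡ Φ (iterΦ i χ) a
iterΦ-suc zero χ a = refl
iterΦ-suc (suc i) χ a = iterΦ-suc i (Φ χ) a

iterΦ-step : ∀ i (χ : ℕ → ℕ) a → iterΦ (suc i) χ (suc a) ≡ iterΦ (suc i) χ a + iterΦ i χ (2 + a)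
iterΦ-step i χ a = begin
  iterΦ (suc i) χ (suc a)                     ≡⟨ iterΦ-suc i χ (suc a) ⟩
  Φ (iterΦ i χ) (suc a)                       ≡⟨ Σ<-suc (suc a) (λ t → iterΦ i χ (suc t)) ⟩
  Φ (iterΦ i χ) a + iterΦ i χ (2 + a)         ≡⟨ cong (_+ iterΦ i χ (2 + a)) (iterΦ-suc i χ a) ⟨
  iterΦ (suc i) χ a + iterΦ i χ (2 + a)       ∎
  where open ≡-Reasoning

iterΦ-at-zero : ∀ i (χ : ℕ → ℕ) → iterΦ (suc i) χ 0 ≡ iterΦ i χ 1
iterΦ-at-zero i χ = trans (iterΦ-suc i χ 0) (+-identityʳ _)

β : ℕ → ℕ → ℕ
β j = iterΦ j (λ _ → 1)

β-one : ∀ a → β 1 a ≡ suc a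
β-one a = Σ<-one (suc a)

β-step : ∀ i a → β (suc i) (suc a) ≡ β (suc i) a + β i (2 + a)
β-step i = iterΦ-step i (λ _ → 1)

row : ℕ → ℕ → ℕ
row zero k = k
row (suc j) k = suc (suc (row j k))

row-suc : ∀ j k → row j (suc k) ≡ suc (row j k)
row-suc zero k = refl
row-suc (suc j) k = cong (λ z → suc (suc z)) (row-suc j k)

row≡ : ∀ j k → row j k ≡ k + j + j
row≡ zero k = sym (trans (+-identityʳ (k + 0)) (+-identityʳ k))
row≡ (suc j) k = trans (cong (λ z → suc (suc z)) (row≡ j k)) (rearrange k j)
  where
  rearrange : ∀ k j → suc (suc (k + j + j)) ≡ k + suc j + suc j
  rearrange = solve-∀

C-prev : ℕ → ℕ → ℕ
C-prev n zero = 0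
C-prev n (suc j) = n C j

C-pascal : ∀ n j → C-prev n j + n C j ≡ suc n C j
C-pascal n zero = refl
C-pascal n (suc j) = nCk+nC[k+1]≡[n+1]C[k+1] n j

β-difference : ∀ j k → β j k + C-prev (row j k) j ≡ row j k C j
β-difference zero k = refl
β-difference (suc j) zero = begin
  β (suc j) 0 + suc (suc m) C j              ≡⟨ cong₂ _+_ (iterΦ-at-zero j (λ _ → 1)) (sym (C-pascal (suc m) j)) ⟩
  β j 1 + (C-prev (suc m) j + suc m C j)     ≡⟨ +-assoc (β j 1) _ _ ⟨
  β j 1 + C-prev (suc m) j + suc m C j       ≡⟨ cong (_+ suc m C j) ih ⟩
  suc m C j + suc m C j                      ≡⟨ cong (_+_ (suc m C j)) symmetric ⟨
  suc m C j + suc m C suc j                  ≡⟨ nCk+nC[k+1]≡[n+1]C[k+1] (suc m) j ⟩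
  suc (suc m) C suc j                        ∎
  where
  open ≡-Reasoning
  m = row j 0
  ih : β j 1 + C-prev (suc m) j ≡ suc m C j
  ih = subst (λ z → β j 1 + C-prev z j ≡ z C j) (row-suc j 0) (β-difference j 1)
  symmetric : suc m C suc j ≡ suc m C j
  symmetric = trans (nCk≡nC[n∸k] (s≤s (subst (j ≤_) (sym (row≡ j 0)) (m≤m+n j j))))
                    (cong (suc m C_) (trans (cong (_∸ j) (row≡ j 0)) (m+n∸m≡n j j)))
β-difference (suc j) (suc k) = subst (λ z → β (suc j) (suc k) + C-prev z (suc j) ≡ z C suc j)
                                     (sym (cong (λ z → suc (suc z)) (row-suc j k))) (begin
  β (suc j) (suc k) + n C j                                       ≡⟨ cong₂ _+_ (β-step j k)
      (sym (C-pascal (suc (suc m)) j)) ⟩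
  (β (suc j) k + β j (2 + k)) + (C-prev (suc (suc m)) j + suc (suc m) C j)
                                                                  ≡⟨ interchange′ (β (suc j) k) (β j (2 + k)) _ _ ⟩
  (β (suc j) k + suc (suc m) C j) + (β j (2 + k) + C-prev (suc (suc m)) j)
                                                                  ≡⟨ cong₂ _+_ (β-difference (suc j) k) ih ⟩
  suc (suc m) C suc j + suc (suc m) C j                           ≡⟨ +-comm (suc (suc m) C suc j) _ ⟩
  suc (suc m) C j + suc (suc m) C suc j                           ≡⟨ nCk+nC[k+1]≡[n+1]C[k+1] (suc (suc m)) j ⟩
  n C suc j                                                       ∎)
  where
  open ≡-Reasoning
  m = row j k
  n = suc (suc (suc m))
  ih : β j (2 + k) + C-prev (suc (suc m)) j ≡ suc (suc m) C j
  ih = subst (λ z → β j (2 + k) + C-prev z j ≡ z C j) (trans (row-suc j (suc k)) (cong suc (row-suc j k)))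
             (β-difference j (2 + k))
  interchange′ : ∀ a b c d → (a + b) + (c + d) ≡ (a + d) + (b + c)
  interchange′ = solve-∀

C-absorption : ∀ n j → suc j * (n C suc j) ≡ (n ∸ j) * (n C j)
C-absorption zero j =
  trans (cong (suc j *_) (k>n⇒nCk≡0 {0} {suc j} z<s)) (trans (*-zeroʳ (suc j)) (sym (cong (_* (0 C j)) (0∸n≡0 j))))
C-absorption (suc n) zero = trans (+-identityʳ _) (trans (nC1≡n (suc n)) (sym (*-identityʳ (suc n))))
C-absorption (suc n) (suc j) = begin
  suc (suc j) * (suc n C suc (suc j))                             ≡⟨ cong (suc (suc j) *_)
      (nCk+nC[k+1]≡[n+1]C[k+1] n (suc j)) ⟨
  suc (suc j) * (n C suc j + n C suc (suc j))                     ≡⟨ *-distribˡ-+ (suc (suc j)) (n C suc j) _ ⟩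
  suc (suc j) * (n C suc j) + suc (suc j) * (n C suc (suc j))     ≡⟨ cong (_+_ (suc (suc j) * (n C suc j)))
      (C-absorption n (suc j)) ⟩
  suc (suc j) * (n C suc j) + (n ∸ suc j) * (n C suc j)           ≡⟨ *-distribʳ-+ (n C suc j) (suc (suc j)) (n ∸ suc j) ⟨
  (suc (suc j) + (n ∸ suc j)) * (n C suc j)                       ≡⟨ factor ⟩
  (suc j + (n ∸ j)) * (n C suc j)                                 ≡⟨ *-distribʳ-+ (n C suc j) (suc j) (n ∸ j) ⟩
  suc j * (n C suc j) + (n ∸ j) * (n C suc j)                     ≡⟨ cong (_+ (n ∸ j) * (n C suc j)) (C-absorption n j) ⟩
  (n ∸ j) * (n C j) + (n ∸ j) * (n C suc j)                       ≡⟨ *-distribˡ-+ (n ∸ j) (n C j) (n C suc j) ⟨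
  (n ∸ j) * (n C j + n C suc j)                                   ≡⟨ cong ((n ∸ j) *_) (nCk+nC[k+1]≡[n+1]C[k+1] n j) ⟩
  (n ∸ j) * (suc n C suc j)                                       ∎
  where
  open ≡-Reasoning
  factor : (suc (suc j) + (n ∸ suc j)) * (n C suc j) ≡ (suc j + (n ∸ j)) * (n C suc j)
  factor with suc j ≤? n
  ... | yes p = cong (λ z → suc z * (n C suc j)) (trans (m+[n∸m]≡n p) (sym (m+[n∸m]≡n (≤-trans (n≤1+n j) p))))
  ... | no np = begin
    (suc (suc j) + (n ∸ suc j)) * (n C suc j)    ≡⟨ cong ((suc (suc j) + (n ∸ suc j)) *_) vanish ⟩
    (suc (suc j) + (n ∸ suc j)) * 0              ≡⟨ *-zeroʳ (suc (suc j) + (n ∸ suc j)) ⟩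
    0                                            ≡⟨ *-zeroʳ (suc j + (n ∸ j)) ⟨
    (suc j + (n ∸ j)) * 0                        ≡⟨ cong ((suc j + (n ∸ j)) *_) vanish ⟨
    (suc j + (n ∸ j)) * (n C suc j)              ∎
    where
    vanish : n C suc j ≡ 0
    vanish = k>n⇒nCk≡0 (≰⇒> np)

C-prev-absorption : ∀ j k → suc (k + j) * C-prev (row j k) j ≡ j * (row j k C j)
C-prev-absorption zero k = *-zeroʳ (suc (k + 0))
C-prev-absorption (suc i) k = trans (cong (_* (n C i)) (sym n∸i)) (sym (C-absorption n i))
  where
  n = row (suc i) k
  rearrange : ∀ k i → suc (suc (k + i + i)) ≡ suc (suc (k + i)) + i
  rearrange = solve-∀
  n∸i : n ∸ i ≡ suc (k + suc i)
  n∸i = begin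
    suc (suc (row i k)) ∸ i       ≡⟨ cong (λ z → suc (suc z) ∸ i) (row≡ i k) ⟩
    suc (suc (k + i + i)) ∸ i     ≡⟨ cong (_∸ i) (rearrange k i) ⟩
    suc (suc (k + i)) + i ∸ i     ≡⟨ m+n∸n≡m (suc (suc (k + i))) i ⟩
    suc (suc (k + i))             ≡⟨ cong suc (+-suc k i) ⟨
    suc (k + suc i)               ∎
    where open ≡-Reasoning

β-closed : ∀ j k → suc (k + j) * β j k ≡ suc k * (row j k C j)
β-closed j k = +-cancelʳ-≡ (j * (n C j)) _ _ (begin
  suc (k + j) * β j k + j * (n C j)                 ≡⟨ cong (_+_ (suc (k + j) * β j k)) (C-prev-absorption j k) ⟨
  suc (k + j) * β j k + suc (k + j) * C-prev n j    ≡⟨ *-distribˡ-+ (suc (k + j)) (β j k) (C-prev n j) ⟨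
  suc (k + j) * (β j k + C-prev n j)                ≡⟨ cong (suc (k + j) *_) (β-difference j k) ⟩
  suc (k + j) * (n C j)                             ≡⟨ split k j (n C j) ⟩
  suc k * (n C j) + j * (n C j)                     ∎)
  where
  open ≡-Reasoning
  n = row j k
  split : ∀ k j c → suc (k + j) * c ≡ suc k * c + j * c
  split = solve-∀

-- βₛ (4 + j) = β j and βₛ c = 0 for c < 4; with this offset C_i(N, k) = βₛ (N + 4 ∸ i ∸ k) k for i ≤ N, 1 ≤ k.
βₛ : ℕ → ℕ → ℕ
βₛ (suc (suc (suc (suc m)))) = β m
βₛ _ _ = 0

βₛ-step : ∀ c x → βₛ (suc c) (suc x) ≡ βₛ (suc c) x + βₛ c (2 + x)
βₛ-step 0 x = refl
βₛ-step 1 x = refl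
βₛ-step 2 x = refl
βₛ-step 3 x = refl
βₛ-step (suc (suc (suc (suc m)))) x = β-step m x

βₛ-at-zero : ∀ m → βₛ (5 + m) 0 ≡ βₛ (4 + m) 1
βₛ-at-zero m = iterΦ-at-zero m (λ _ → 1)

cong₃ : ∀ {A B C D : Set} (f : A → B → C → D) {a a′ b b′ c c′} → a ≡ a′ → b ≡ b′ → c ≡ c′ → f a b c ≡ f a′ b′ c′
cong₃ f refl refl refl = refl

≡-by-increments : ∀ {X Y D E : ℕ → ℕ} → X 0 ≡ Y 0 →
                  (∀ a → X (suc a) ≡ X a + D a) → (∀ a → Y (suc a) ≡ Y a + E a) →
                  (∀ a → D a ≡ E a) → ∀ a → X a ≡ Y a
≡-by-increments base dX dY dD≡dE zero = base
≡-by-increments base dX dY dD≡dE (suc a) =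
  trans (dX a) (trans (cong₂ _+_ (≡-by-increments base dX dY dD≡dE a) (dD≡dE a)) (sym (dY a)))

kept : ℕ → ℕ → ℕ
kept r = winsFrom r holding

winsFrom-lost : ∀ r l → winsFrom r lost l ≡ 0
winsFrom-lost zero l = refl
winsFrom-lost (suc r) l = cong₂ _+_ (winsFrom-lost r (suc l)) (trans (Σ<-cong l (λ c → winsFrom-lost r (suc c))) (Σ<-zero l))

kept-1 : ∀ x → kept 1 x ≡ x
kept-1 = Σ<-one

kept-step : ∀ r x → kept (suc r) (suc x) ≡ kept (suc r) x + kept r (suc x)
kept-step r x = begin
  winsFrom r lost (2 + x) + Σ< (suc x) (λ c → kept r (suc c))       ≡⟨ cong₂ _+_ (winsFrom-lost r (2 + x))
      (Σ<-suc x (λ c → kept r (suc c))) ⟩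
  Σ< x (λ c → kept r (suc c)) + kept r (suc x)                        ≡⟨ cong
      (λ z → z + Σ< x (λ c → kept r (suc c)) + kept r (suc x)) (winsFrom-lost r (suc x)) ⟨
  winsFrom r lost (suc x) + Σ< x (λ c → kept r (suc c)) + kept r (suc x) ∎
  where open ≡-Reasoning

winsFrom-2 : ∀ x → winsFrom 2 searching x ≡ suc x + x
winsFrom-2 x = cong₂ _+_ (kept-1 (suc x)) (trans (Σ<-cong x (λ c → cong suc (Σ<-zero (suc c)))) (Σ<-one x))

winsFrom-3-step : ∀ y → winsFrom 3 searching (4 + y) ≡ winsFrom 3 searching (3 + y) +
    (kept 1 (5 + y) + winsFrom 2 searching (4 + y))
winsFrom-3-step y =
  trans (cong₂ _+_ (kept-step 1 (4 + y)) (Σ<-suc (3 + y) (λ c → winsFrom 2 searching (suc c))))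
        (interchange (kept 2 (4 + y)) _ _ _)

winsFrom-4-step : ∀ y → winsFrom 4 searching (9 + y) ≡ winsFrom 4 searching (8 + y) +
    (kept 2 (10 + y) + winsFrom 3 searching (9 + y))
winsFrom-4-step y =
  trans (cong₂ _+_ (kept-step 2 (9 + y)) (Σ<-suc (8 + y) (λ c → winsFrom 3 searching (suc c))))
        (interchange (kept 3 (9 + y)) _ _ _)

layer₀-increments : ∀ y → kept 2 (10 + y) + winsFrom 3 searching (9 + y) + 9 * β 1 (10 + y) ≡ 4 * β 2 (10 + y)
layer₀-increments = ≡-by-increments refl step (λ y → trans (cong (4 *_) (β-step 1 (10 + y)))
    (*-distribˡ-+ 4 (β 2 (10 + y)) (β 1 (12 + y)))) increment
  where
  step : ∀ y → kept 2 (11 + y) + winsFrom 3 searching (10 + y) + 9 * β 1 (11 + y)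
             ≡ kept 2 (10 + y) + winsFrom 3 searching (9 + y) + 9 * β 1 (10 + y)
               + (kept 1 (11 + y) + (kept 1 (11 + y) + winsFrom 2 searching (10 + y)) + 9)
  step y = trans (cong₃ (λ a b c → a + b + 9 * c) (kept-step 1 (10 + y)) (winsFrom-3-step (6 + y)) (β-step 0 (10 + y)))
                 (shuffle (kept 2 (10 + y)) (kept 1 (11 + y)) (winsFrom 3 searching (9 + y))
                          (kept 1 (11 + y) + winsFrom 2 searching (10 + y)) (β 1 (10 + y)))
    where
    shuffle : ∀ k k′ w w′ b → k + k′ + (w + w′) + 9 * (b + 1) ≡ k + w + 9 * b + (k′ + w′ + 9)
    shuffle = solve-∀
  increment : ∀ y → kept 1 (11 + y) + (kept 1 (11 + y) + winsFrom 2 searching (10 + y)) + 9 ≡ 4 * β 1 (12 + y)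
  increment y = begin
    kept 1 (11 + y) + (kept 1 (11 + y) + winsFrom 2 searching (10 + y)) + 9
      ≡⟨ cong₂ (λ a b → a + (a + b) + 9) (kept-1 (11 + y)) (winsFrom-2 (10 + y)) ⟩
    11 + y + (11 + y + (suc (10 + y) + (10 + y))) + 9
      ≡⟨ arithmetic y ⟩
    4 * suc (12 + y)
      ≡⟨ cong (4 *_) (β-one (12 + y)) ⟨
    4 * β 1 (12 + y) ∎
    where
    open ≡-Reasoning
    arithmetic : ∀ y → 11 + y + (11 + y + (suc (10 + y) + (10 + y))) + 9 ≡ 4 * suc (12 + y)
    arithmetic = solve-∀

-- For N = 4 + i + k, lhs i k and rhs i k are the two sides of Theorem 4.11 with the negative terms moved left,
-- written with Bc(N, k) = iterΦ i (winsFrom 4 searching) k and C_c(N, k) = βₛ (N + 4 ∸ c ∸ k) k.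
lhs : ℕ → ℕ → ℕ
lhs i x = iterΦ i (winsFrom 4 searching) x + 9 * βₛ (6 + i) x + 206 * βₛ (2 + i) x + 5 * βₛ i x

rhs : ℕ → ℕ → ℕ
rhs i x = 4 * βₛ (7 + i) x + 2 * βₛ (4 + i) x + 105 * βₛ (3 + i) x + 95 * βₛ (1 + i) x

cong₄ : ∀ {A B C D E : Set} (f : A → B → C → D → E) {a a′ b b′ c c′ d d′} →
        a ≡ a′ → b ≡ b′ → c ≡ c′ → d ≡ d′ → f a b c d ≡ f a′ b′ c′ d′
cong₄ f refl refl refl refl = refl

lhs-step : ∀ i x → lhs (suc i) (suc x) ≡ lhs (suc i) x + lhs i (2 + x)
lhs-step i x =
  trans (cong₄ (λ a b c d → a + 9 * b + 206 * c + 5 * d)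
               (iterΦ-step i (winsFrom 4 searching) x) (βₛ-step (6 + i) x) (βₛ-step (2 + i) x) (βₛ-step i x))
        (shuffle (iterΦ (suc i) (winsFrom 4 searching) x) (iterΦ i (winsFrom 4 searching) (2 + x))
                 (βₛ (7 + i) x) (βₛ (6 + i) (2 + x)) (βₛ (3 + i) x) (βₛ (2 + i) (2 + x)) (βₛ (suc i) x) (βₛ i (2 + x)))
  where
  shuffle : ∀ a a′ b b′ c c′ d d′ → (a + a′) + 9 * (b + b′) + 206 * (c + c′) + 5 * (d + d′)
                                    ≡ (a + 9 * b + 206 * c + 5 * d) + (a′ + 9 * b′ + 206 * c′ + 5 * d′)
  shuffle = solve-∀

rhs-step : ∀ i x → rhs (suc i) (suc x) ≡ rhs (suc i) x + rhs i (2 + x)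
rhs-step i x =
  trans (cong₄ (λ a b c d → 4 * a + 2 * b + 105 * c + 95 * d)
               (βₛ-step (7 + i) x) (βₛ-step (4 + i) x) (βₛ-step (3 + i) x) (βₛ-step (1 + i) x))
        (shuffle (βₛ (8 + i) x) (βₛ (7 + i) (2 + x)) (βₛ (5 + i) x) (βₛ (4 + i) (2 + x))
                 (βₛ (4 + i) x) (βₛ (3 + i) (2 + x)) (βₛ (2 + i) x) (βₛ (1 + i) (2 + x)))
  where
  shuffle : ∀ a a′ b b′ c c′ d d′ → 4 * (a + a′) + 2 * (b + b′) + 105 * (c + c′) + 95 * (d + d′)
                                    ≡ (4 * a + 2 * b + 105 * c + 95 * d) + (4 * a′ + 2 * b′ + 105 * c′ + 95 * d′)
  shuffle = solve-∀

layer₀ : ∀ a → lhs 0 (8 + a) ≡ rhs 0 (8 + a)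
layer₀ = ≡-by-increments refl stepˡ stepʳ layer₀-increments
  where
  stepˡ : ∀ a → lhs 0 (9 + a) ≡ lhs 0 (8 + a) + (kept 2 (10 + a) + winsFrom 3 searching (9 + a) + 9 * β 1 (10 + a))
  stepˡ a = trans (cong₂ (λ u v → u + 9 * v + 206 * 0 + 5 * 0) (winsFrom-4-step a) (β-step 1 (8 + a)))
                  (shuffle (winsFrom 4 searching (8 + a)) (kept 2 (10 + a)) (winsFrom 3 searching (9 + a))
                           (β 2 (8 + a)) (β 1 (10 + a)))
    where
    shuffle : ∀ w k t b b′ → w + (k + t) + 9 * (b + b′) + 206 * 0 + 5 * 0 ≡ w + 9 * b + 206 * 0 + 5 * 0 + (k + t + 9 * b′)
    shuffle = solve-∀
  stepʳ : ∀ a → rhs 0 (9 + a) ≡ rhs 0 (8 + a) + 4 * β 2 (10 + a)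
  stepʳ a = trans (cong (λ v → 4 * v + 2 * 1 + 105 * 0 + 95 * 0) (β-step 2 (8 + a)))
                  (shuffle (β 3 (8 + a)) (β 2 (10 + a)))
    where
    shuffle : ∀ b b′ → 4 * (b + b′) + 2 * 1 + 105 * 0 + 95 * 0 ≡ 4 * b + 2 * 1 + 105 * 0 + 95 * 0 + 4 * b′
    shuffle = solve-∀

σ : ℕ → ℕ
σ 0 = 8
σ 1 = 6
σ 2 = 4
σ 3 = 2
σ 4 = 1
σ _ = 0

σ-step : ∀ i → σ i ≤ 2 + σ (suc i)
σ-step 0 = ≤-refl
σ-step 1 = ≤-refl
σ-step 2 = ≤-refl
σ-step 3 = n≤1+n 2
σ-step 4 = s≤s z≤n
σ-step (suc (suc (suc (suc (suc i))))) = z≤n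

σ≤1 : ∀ i → σ (4 + i) ≤ 1
σ≤1 zero = ≤-refl
σ≤1 (suc i) = z≤n

lhs-at-zero : ∀ i → lhs (5 + i) 0 ≡ lhs (4 + i) 1
lhs-at-zero i = cong₄ (λ a b c d → a + 9 * b + 206 * c + 5 * d)
                      (iterΦ-at-zero (4 + i) (winsFrom 4 searching)) (βₛ-at-zero (6 + i)) (βₛ-at-zero (2 + i)) (βₛ-at-zero i)

rhs-at-zero : ∀ i → rhs (5 + i) 0 ≡ rhs (4 + i) 1
rhs-at-zero i = cong₄ (λ a b c d → 4 * a + 2 * b + 105 * c + 95 * d)
                      (βₛ-at-zero (7 + i)) (βₛ-at-zero (4 + i)) (βₛ-at-zero (3 + i)) (βₛ-at-zero (1 + i))

Layer : ℕ → Set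
Layer i = ∀ x → σ i ≤ x → lhs i x ≡ rhs i x

layer-step : ∀ i → Layer i → lhs (suc i) (σ (suc i)) ≡ rhs (suc i) (σ (suc i)) → Layer (suc i)
layer-step i layer-i base x s≤x = subst (λ z → lhs (suc i) z ≡ rhs (suc i) z) (m∸n+n≡m s≤x) (offset (x ∸ s))
  where
  s = σ (suc i)
  offset : ∀ a → lhs (suc i) (a + s) ≡ rhs (suc i) (a + s)
  offset = ≡-by-increments base (λ a → lhs-step i (a + s)) (λ a → rhs-step i (a + s))
                           (λ a → layer-i (2 + (a + s)) (≤-trans (σ-step i) (+-monoʳ-≤ 2 (m≤n+m s a))))

layer-base : ∀ i → Layer i → lhs (suc i) (σ (suc i)) ≡ rhs (suc i) (σ (suc i))
layer-base 0 _ = refl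
layer-base 1 _ = refl
layer-base 2 _ = refl
layer-base 3 _ = refl
layer-base (suc (suc (suc (suc i)))) layer-i =
  trans (lhs-at-zero i) (trans (layer-i 1 (σ≤1 i)) (sym (rhs-at-zero i)))

layer : ∀ i → Layer i
layer zero x 8≤x = subst (λ z → lhs 0 z ≡ rhs 0 z) (m+[n∸m]≡n 8≤x) (layer₀ (x ∸ 8))
layer (suc i) = layer-step i (layer i) (layer-base i (layer i))

ballotℕ : ℕ → ℕ → ℕ
ballotℕ M k = if k ≤ᵇ M then β (M ∸ k) k else 0

ballotℕ-binomial : ∀ M k → 1 ≤ M → suc k * ((2 * M ∸ k) C M) ≡ suc M * ballotℕ M k
ballotℕ-binomial M k 1≤M with k ≤? M
... | yes k≤M = subst (λ z → suc k * ((2 * z ∸ k) C z) ≡ suc z * ballotℕ z k) (m+[n∸m]≡n k≤M) (begin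
  suc k * ((2 * (k + j) ∸ k) C (k + j))    ≡⟨ cong (λ z → suc k * (z C (k + j))) top ⟩
  suc k * (n C (k + j))                    ≡⟨ cong (suc k *_) (trans (nCk≡nC[n∸k] k+j≤n) (cong (n C_) n∸[k+j])) ⟩
  suc k * (n C j)                          ≡⟨ β-closed j k ⟨
  suc (k + j) * β j k                      ≡⟨ cong (λ z → suc (k + j) * β z k) (m+n∸m≡n k j) ⟨
  suc (k + j) * β (k + j ∸ k) k            ≡⟨ cong (suc (k + j) *_) (if-true (≤ᵇ-true (m≤m+n k j))) ⟨
  suc (k + j) * ballotℕ (k + j) k          ∎)
  where
  open ≡-Reasoning
  j = M ∸ k
  n = row j k
  double : ∀ k j → 2 * (k + j) ≡ k + (k + j + j)
  double = solve-∀
  top : 2 * (k + j) ∸ k ≡ n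
  top = trans (cong (_∸ k) (double k j)) (trans (m+n∸m≡n k (k + j + j)) (sym (row≡ j k)))
  k+j≤n : k + j ≤ n
  k+j≤n = subst (k + j ≤_) (sym (row≡ j k)) (m≤m+n (k + j) j)
  n∸[k+j] : n ∸ (k + j) ≡ j
  n∸[k+j] = trans (cong (_∸ (k + j)) (row≡ j k)) (m+n∸m≡n (k + j) j)
... | no k≰M = begin
  suc k * ((2 * M ∸ k) C M)    ≡⟨ cong (suc k *_) (k>n⇒nCk≡0 too-small) ⟩
  suc k * 0                    ≡⟨ *-zeroʳ (suc k) ⟩
  0                            ≡⟨ *-zeroʳ (suc M) ⟨
  suc M * 0                    ≡⟨ cong (suc M *_) (if-false (≤ᵇ-false (≰⇒> k≰M))) ⟨
  suc M * ballotℕ M k          ∎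
  where
  open ≡-Reasoning
  too-small : 2 * M ∸ k < M
  too-small with k ≤? 2 * M
  ... | yes k≤2M = subst (2 * M ∸ k <_) (trans (cong (_∸ M) (double M)) (m+n∸n≡m M M)) (∸-monoʳ-< (≰⇒> k≰M) k≤2M)
    where
    double : ∀ M → 2 * M ≡ M + M
    double = solve-∀
  ... | no k≰2M = subst (_< M) (sym (m≤n⇒m∸n≡0 (≤-trans (n≤1+n _) (≰⇒> k≰2M)))) 1≤M

ballotℕ-βₛ : ∀ d k → 1 ≤ k → ballotℕ (d + k ∸ 4) k ≡ βₛ d k
ballotℕ-βₛ (suc (suc (suc (suc m)))) k _ =
  trans (if-true (≤ᵇ-true (m≤n+m k m))) (cong (λ z → β z k) (m+n∸n≡m m k))
ballotℕ-βₛ 0 (suc k) _ = if-false (≤ᵇ-false {suc k} (s≤s (m∸n≤m k 3)))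
ballotℕ-βₛ 1 (suc k) _ = if-false (≤ᵇ-false {suc k} (s≤s (m∸n≤m k 2)))
ballotℕ-βₛ 2 (suc k) _ = if-false (≤ᵇ-false {suc k} (s≤s (m∸n≤m k 1)))
ballotℕ-βₛ 3 (suc k) _ = if-false (≤ᵇ-false {suc k} {k} ≤-refl)

Identityℕ : ℕ → ℕ → Set
Identityℕ N k = Bc149 N k + 9 * ballotℕ (N ∸ 2) k + 206 * ballotℕ (N ∸ 6) k + 5 * ballotℕ (N ∸ 8) k
              ≡ 4 * ballotℕ (N ∸ 1) k + 2 * ballotℕ (N ∸ 4) k + 105 * ballotℕ (N ∸ 5) k + 95 * ballotℕ (N ∸ 7) k

identityℕ-layer : ∀ j k → 1 ≤ k → σ (suc j) ≤ k → Identityℕ (5 + j + k) k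
identityℕ-layer j k 1≤k σ≤k = begin
  Bc149 (5 + j + k) k + 9 * b 2 + 206 * b 6 + 5 * b 8
    ≡⟨ cong₄ (λ a x y z → a + 9 * x + 206 * y + 5 * z)
             (Bc149≡iterΦ j k) (ballotℕ-βₛ (7 + j) k 1≤k) (ballotℕ-βₛ (3 + j) k 1≤k) (ballotℕ-βₛ (1 + j) k 1≤k) ⟩
  lhs (suc j) k
    ≡⟨ layer (suc j) k σ≤k ⟩
  rhs (suc j) k
    ≡⟨ cong₄ (λ a x y z → 4 * a + 2 * x + 105 * y + 95 * z)
             (ballotℕ-βₛ (8 + j) k 1≤k) (ballotℕ-βₛ (5 + j) k 1≤k) (ballotℕ-βₛ (4 + j) k 1≤k) (ballotℕ-βₛ (2 + j) k 1≤k) ⟨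
  4 * b 1 + 2 * b 4 + 105 * b 5 + 95 * b 7 ∎
  where
  open ≡-Reasoning
  b : ℕ → ℕ
  b c = ballotℕ (5 + j + k ∸ c) k

σ-bound : ∀ j k → 1 ≤ k → 11 ≤ 5 + j + k → σ (suc j) ≤ k
σ-bound 0 k _ 11≤N = +-cancelˡ-≤ 5 6 k 11≤N
σ-bound 1 k _ 11≤N = ≤-trans (n≤1+n 4) (+-cancelˡ-≤ 6 5 k 11≤N)
σ-bound 2 k _ 11≤N = ≤-trans (m≤n+m 2 2) (+-cancelˡ-≤ 7 4 k 11≤N)
σ-bound 3 k 1≤k _ = 1≤k
σ-bound (suc (suc (suc (suc j)))) k _ _ = z≤n

identityℕ : ∀ N k → 11 ≤ N → 1 ≤ k → k ≤ N ∸ 5 → Identityℕ N k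
identityℕ N k 11≤N 1≤k k≤N∸5 =
  subst (λ M → Identityℕ M k) N≡ (identityℕ-layer j k 1≤k (σ-bound j k 1≤k (subst (11 ≤_) (sym N≡) 11≤N)))
  where
  j = N ∸ 5 ∸ k
  N≡ : 5 + j + k ≡ N
  N≡ = trans (+-assoc 5 j k) (trans (cong (λ z → 5 + z) (m∸n+n≡m k≤N∸5)) (m+[n∸m]≡n (≤-trans (m≤m+n 5 6) 11≤N)))

ι : ℤ → ℚ
ι z = z ℚ./ 1

ι-+ : ∀ x y → ι (x ℤ.+ y) ≡ ι x ℚ.+ ι y
ι-+ x y = toℚᵘ-injective (ℚᵘ.≃-trans (toℚᵘ-fromℚᵘ (mkℚᵘ (x ℤ.+ y) 0)) (ℚᵘ.≃-trans (*≡* (unnormalised x y))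
            (ℚᵘ.≃-sym (ℚᵘ.≃-trans (toℚᵘ-homo-+ (ι x) (ι y)) (ℚᵘ.+-cong (toℚᵘ-fromℚᵘ (mkℚᵘ x 0)) (toℚᵘ-fromℚᵘ (mkℚᵘ y 0)))))))
  where
  unnormalised : ∀ x y → (x ℤ.+ y) ℤ.* + 1 ≡ (x ℤ.* + 1 ℤ.+ y ℤ.* + 1) ℤ.* + 1
  unnormalised = ℤ-Solver.solve-∀

ι-* : ∀ x y → ι (x ℤ.* y) ≡ ι x ℚ.* ι y
ι-* x y = toℚᵘ-injective (ℚᵘ.≃-trans (toℚᵘ-fromℚᵘ (mkℚᵘ (x ℤ.* y) 0)) (ℚᵘ.≃-trans (*≡* refl)
            (ℚᵘ.≃-sym (ℚᵘ.≃-trans (toℚᵘ-homo-* (ι x) (ι y)) (ℚᵘ.*-cong (toℚᵘ-fromℚᵘ (mkℚᵘ x 0)) (toℚᵘ-fromℚᵘ (mkℚᵘ y 0)))))))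

ι-neg : ∀ x → ι (ℤ.- x) ≡ ℚ.- ι x
ι-neg x = toℚᵘ-injective (ℚᵘ.≃-trans (toℚᵘ-fromℚᵘ (mkℚᵘ (ℤ.- x) 0))
            (ℚᵘ.≃-sym (ℚᵘ.≃-trans (toℚᵘ-homo‿- (ι x)) (ℚᵘ.-‿cong (toℚᵘ-fromℚᵘ (mkℚᵘ x 0))))))

ι-- : ∀ x y → ι (x ℤ.- y) ≡ ι x ℚ.- ι y
ι-- x y = trans (ι-+ x (ℤ.- y)) (cong (ι x ℚ.+_) (ι-neg y))

ι-+* : ∀ x c y → ι (x ℤ.+ c ℤ.* y) ≡ ι x ℚ.+ ι c ℚ.* ι y
ι-+* x c y = trans (ι-+ x (c ℤ.* y)) (cong (ι x ℚ.+_) (ι-* c y))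

ι--* : ∀ x c y → ι (x ℤ.- c ℤ.* y) ≡ ι x ℚ.- ι c ℚ.* ι y
ι--* x c y = trans (ι-- x (c ℤ.* y)) (cong (λ z → ι x ℚ.- z) (ι-* c y))

ι-cancel : ∀ d x → (+ (suc d * x)) ℚ./ suc d ≡ ι (+ x)
ι-cancel d x = fromℚᵘ-cong {mkℚᵘ (+ (suc d * x)) d} {mkℚᵘ (+ x) 0} (*≡* cross)
  where
  commute : ∀ d x → suc d * x * 1 ≡ x * suc d
  commute = solve-∀
  cross : + (suc d * x) ℤ.* + 1 ≡ + x ℤ.* + (suc d)
  cross = trans (sym (ℤ.pos-* (suc d * x) 1)) (trans (cong +_ (commute d x)) (ℤ.pos-* x (suc d)))

ballot≡ballotℕ : ∀ i N k → i < N → ballot i N k ≡ ι (+ ballotℕ (N ∸ i) k)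
ballot≡ballotℕ i N k i<N =
  trans (cong (λ z → (+ z) ℚ./ suc (N ∸ i)) (ballotℕ-binomial (N ∸ i) k (m<n⇒0<n∸m i<N)))
      (ι-cancel (N ∸ i) (ballotℕ (N ∸ i) k))

transpose : ∀ x b₁ b₂ b₄ b₅ b₆ b₇ b₈ →
  x ℤ.+ + 9 ℤ.* b₂ ℤ.+ + 206 ℤ.* b₆ ℤ.+ + 5 ℤ.* b₈ ≡ + 4 ℤ.* b₁ ℤ.+ + 2 ℤ.* b₄ ℤ.+ + 105 ℤ.* b₅ ℤ.+ + 95 ℤ.* b₇ →
  x ≡ + 4 ℤ.* b₁ ℤ.- + 9 ℤ.* b₂ ℤ.+ + 2 ℤ.* b₄ ℤ.+ + 105 ℤ.* b₅ ℤ.- + 206 ℤ.* b₆ ℤ.+ + 95 ℤ.* b₇ ℤ.- + 5 ℤ.* b₈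
transpose x b₁ b₂ b₄ b₅ b₆ b₇ b₈ balance = begin
  x                                                                               ≡⟨ add-subtract x b₂ b₆ b₈ ⟩
  (x ℤ.+ + 9 ℤ.* b₂ ℤ.+ + 206 ℤ.* b₆ ℤ.+ + 5 ℤ.* b₈) ℤ.- negatives                 ≡⟨ cong (ℤ._- negatives) balance ⟩
  (+ 4 ℤ.* b₁ ℤ.+ + 2 ℤ.* b₄ ℤ.+ + 105 ℤ.* b₅ ℤ.+ + 95 ℤ.* b₇) ℤ.- negatives       ≡⟨ regroup b₁ b₂ b₄ b₅ b₆ b₇ b₈ ⟩
  + 4 ℤ.* b₁ ℤ.- + 9 ℤ.* b₂ ℤ.+ + 2 ℤ.* b₄ ℤ.+ + 105 ℤ.* b₅ ℤ.- + 206 ℤ.* b₆ ℤ.+ + 95 ℤ.* b₇ ℤ.- + 5 ℤ.* b₈ ∎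
  where
  open ≡-Reasoning
  negatives = + 9 ℤ.* b₂ ℤ.+ + 206 ℤ.* b₆ ℤ.+ + 5 ℤ.* b₈
  add-subtract : ∀ x b₂ b₆ b₈ →
    x ≡ (x ℤ.+ + 9 ℤ.* b₂ ℤ.+ + 206 ℤ.* b₆ ℤ.+ + 5 ℤ.* b₈) ℤ.- (+ 9 ℤ.* b₂ ℤ.+ + 206 ℤ.* b₆ ℤ.+ + 5 ℤ.* b₈)
  add-subtract = ℤ-Solver.solve-∀
  regroup : ∀ b₁ b₂ b₄ b₅ b₆ b₇ b₈ →
    (+ 4 ℤ.* b₁ ℤ.+ + 2 ℤ.* b₄ ℤ.+ + 105 ℤ.* b₅ ℤ.+ + 95 ℤ.* b₇) ℤ.- (+ 9 ℤ.* b₂ ℤ.+ + 206 ℤ.* b₆ ℤ.+ + 5 ℤ.* b₈)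
    ≡ + 4 ℤ.* b₁ ℤ.- + 9 ℤ.* b₂ ℤ.+ + 2 ℤ.* b₄ ℤ.+ + 105 ℤ.* b₅ ℤ.- + 206 ℤ.* b₆ ℤ.+ + 95 ℤ.* b₇ ℤ.- + 5 ℤ.* b₈
  regroup = ℤ-Solver.solve-∀

pos-weighted : ∀ x p y q z r w → + (x + p * y + q * z + r * w) ≡ + x ℤ.+ + p ℤ.* + y ℤ.+ + q ℤ.* + z ℤ.+ + r ℤ.* + w
pos-weighted x p y q z r w = cong₃ (λ u v t → + x ℤ.+ u ℤ.+ v ℤ.+ t) (ℤ.pos-* p y) (ℤ.pos-* q z) (ℤ.pos-* r w)

combination : ℚ → ℚ → ℚ → ℚ → ℚ → ℚ → ℚ → ℚ
combination c₁ c₂ c₄ c₅ c₆ c₇ c₈ =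
  ι (+ 4) ℚ.* c₁ ℚ.- ι (+ 9) ℚ.* c₂ ℚ.+ ι (+ 2) ℚ.* c₄ ℚ.+ ι (+ 105) ℚ.* c₅
    ℚ.- ι (+ 206) ℚ.* c₆ ℚ.+ ι (+ 95) ℚ.* c₇ ℚ.- ι (+ 5) ℚ.* c₈

combination-cong : ∀ {c₁ c₂ c₄ c₅ c₆ c₇ c₈ d₁ d₂ d₄ d₅ d₆ d₇ d₈} →
  c₁ ≡ d₁ → c₂ ≡ d₂ → c₄ ≡ d₄ → c₅ ≡ d₅ → c₆ ≡ d₆ → c₇ ≡ d₇ → c₈ ≡ d₈ →
  combination c₁ c₂ c₄ c₅ c₆ c₇ c₈ ≡ combination d₁ d₂ d₄ d₅ d₆ d₇ d₈
combination-cong refl refl refl refl refl refl refl = refl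

identityℕ⇒ℚ : ∀ x b₁ b₂ b₄ b₅ b₆ b₇ b₈ →
  x + 9 * b₂ + 206 * b₆ + 5 * b₈ ≡ 4 * b₁ + 2 * b₄ + 105 * b₅ + 95 * b₇ →
  ι (+ x) ≡ combination (ι (+ b₁)) (ι (+ b₂)) (ι (+ b₄)) (ι (+ b₅)) (ι (+ b₆)) (ι (+ b₇)) (ι (+ b₈))
identityℕ⇒ℚ x b₁ b₂ b₄ b₅ b₆ b₇ b₈ balance = begin
  ι (+ x)                                      ≡⟨ cong ι
      (transpose (+ x) (+ b₁) (+ b₂) (+ b₄) (+ b₅) (+ b₆) (+ b₇) (+ b₈) balanceℤ) ⟩
  ι (y₅ ℤ.- + 5 ℤ.* + b₈)                      ≡⟨ ι--* y₅ (+ 5) (+ b₈) ⟩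
  ι y₅ ℚ.- ι (+ 5) ℚ.* ι (+ b₈)                ≡⟨ cong (ℚ._- ι (+ 5) ℚ.* ι (+ b₈)) (ι-+* y₄ (+ 95) (+ b₇)) ⟩
  ι y₄ ℚ.+ ι (+ 95) ℚ.* ι (+ b₇) ℚ.- ι (+ 5) ℚ.* ι (+ b₈)
                                               ≡⟨ cong (λ z → z ℚ.+ ι (+ 95) ℚ.* ι (+ b₇) ℚ.- ι (+ 5) ℚ.* ι (+ b₈)) ι-y₄ ⟩
  combination (ι (+ b₁)) (ι (+ b₂)) (ι (+ b₄)) (ι (+ b₅)) (ι (+ b₆)) (ι (+ b₇)) (ι (+ b₈)) ∎
  where
  open ≡-Reasoning
  y₁ = + 4 ℤ.* + b₁ ℤ.- + 9 ℤ.* + b₂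
  y₂ = y₁ ℤ.+ + 2 ℤ.* + b₄
  y₃ = y₂ ℤ.+ + 105 ℤ.* + b₅
  y₄ = y₃ ℤ.- + 206 ℤ.* + b₆
  y₅ = y₄ ℤ.+ + 95 ℤ.* + b₇
  ι-y₁ : ι y₁ ≡ ι (+ 4) ℚ.* ι (+ b₁) ℚ.- ι (+ 9) ℚ.* ι (+ b₂)
  ι-y₁ = trans (ι--* (+ 4 ℤ.* + b₁) (+ 9) (+ b₂)) (cong (ℚ._- ι (+ 9) ℚ.* ι (+ b₂)) (ι-* (+ 4) (+ b₁)))
  ι-y₃ : ι y₃ ≡ ι (+ 4) ℚ.* ι (+ b₁) ℚ.- ι (+ 9) ℚ.* ι (+ b₂) ℚ.+ ι (+ 2) ℚ.* ι (+ b₄) ℚ.+ ι (+ 105) ℚ.* ι (+ b₅)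
  ι-y₃ = trans (ι-+* y₂ (+ 105) (+ b₅)) (cong (ℚ._+ ι (+ 105) ℚ.* ι (+ b₅))
           (trans (ι-+* y₁ (+ 2) (+ b₄)) (cong (ℚ._+ ι (+ 2) ℚ.* ι (+ b₄)) ι-y₁)))
  ι-y₄ : ι y₄ ≡ ι (+ 4) ℚ.* ι (+ b₁) ℚ.- ι (+ 9) ℚ.* ι (+ b₂) ℚ.+ ι (+ 2) ℚ.* ι (+ b₄) ℚ.+ ι (+ 105) ℚ.* ι (+ b₅)
                ℚ.- ι (+ 206) ℚ.* ι (+ b₆)
  ι-y₄ = trans (ι--* y₃ (+ 206) (+ b₆)) (cong (ℚ._- ι (+ 206) ℚ.* ι (+ b₆)) ι-y₃)
  balanceℤ : + x ℤ.+ + 9 ℤ.* + b₂ ℤ.+ + 206 ℤ.* + b₆ ℤ.+ + 5 ℤ.* + b₈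
             ≡ + 4 ℤ.* + b₁ ℤ.+ + 2 ℤ.* + b₄ ℤ.+ + 105 ℤ.* + b₅ ℤ.+ + 95 ℤ.* + b₇
  balanceℤ = trans (sym (pos-weighted x 9 b₂ 206 b₆ 5 b₈))
               (trans (cong +_ balance) (trans (pos-weighted (4 * b₁) 2 b₄ 105 b₅ 95 b₇)
                 (cong (λ u → u ℤ.+ + 2 ℤ.* + b₄ ℤ.+ + 105 ℤ.* + b₅ ℤ.+ + 95 ℤ.* + b₇) (ℤ.pos-* 4 b₁))))

below-11 : ∀ i {N} → T (i <ᵇ 11) → 11 ≤ N → i < N
below-11 i i<11 11≤N = <-≤-trans (<ᵇ⇒< i 11 i<11) 11≤N

theorem4p11 : (N k : ℕ) → 11 ≤ N → 1 ≤ k → k ≤ N Data.Nat.∸ 5 →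
    (+ Bc149 N k) ℚ./ 1
    ≡ (+ 4) ℚ./ 1 ℚ.* ballot 1 N k ℚ.- (+ 9) ℚ./ 1 ℚ.* ballot 2 N k ℚ.+ (+ 2) ℚ./ 1 ℚ.* ballot 4 N k
    ℚ.+ (+ 105) ℚ./ 1 ℚ.* ballot 5 N k ℚ.- (+ 206) ℚ./ 1 ℚ.* ballot 6 N k
    ℚ.+ (+ 95) ℚ./ 1 ℚ.* ballot 7 N k ℚ.- (+ 5) ℚ./ 1 ℚ.* ballot 8 N k
theorem4p11 N k 11≤N 1≤k k≤N∸5 =
  trans (identityℕ⇒ℚ (Bc149 N k) (b 1) (b 2) (b 4) (b 5) (b 6) (b 7) (b 8) (identityℕ N k 11≤N 1≤k k≤N∸5))
        (combination-cong (b≡ 1 _) (b≡ 2 _) (b≡ 4 _) (b≡ 5 _) (b≡ 6 _) (b≡ 7 _) (b≡ 8 _))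
  where
  b : ℕ → ℕ
  b i = ballotℕ (N ∸ i) k
  b≡ : ∀ i → T (i <ᵇ 11) → ι (+ b i) ≡ ballot i N k
  b≡ i i<11 = sym (ballot≡ballotℕ i N k (below-11 i i<11 11≤N))
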